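{- The Nearest Neighbor heuristic for the Euclidean TSP is scalefree (in the simple sense defined in the context).
   Context: **Nearest Neighbor.** Given a finite point set $X\subset\mathbb R^d$, $\textsc{NN}(X)$ begins from a distinguished point $x_0\in X$ and grows a path by choosing, at each step, the point nearest to the current one (the most recently added point) among those not already on the path; in the last step the endpoints of the Hamilton path are joined to create a tour. If there are ties its behavior is unspecified. **General position.** A set of $m$ points with pairwise Euclidean distances $d_1,\dots,d_{\binom m2}$ is in general position if $\sum_i\xi_id_i\ne0$ for every choice of $\xi_i\in\{0,1,-1\}$ not all zero. **Path-finding heuristic.** A polynomial-time path-finding heuristic is an algorithm which has access to a blackbox for comparing sums of distances among the input points and which, given the distance matrix of a point set in general position, outputs a list of Hamilton paths through the point set in time polynomial in the number of points. **Scalefree (simple sense).** $B(p,r)$ denotes the Euclidean ball of radius $r$ centered at $p$. A TSP heuristic $H$ is scalefree if there exist a constant $R$ and a polynomial-time path-finding heuristic $A_H$ such that, given any input set $X$ for $H$, the following implication holds for all sets $S_p=B(p,1)\cap X$: if (a) the annulus $B(p,R)\setminus B(p,1)$ contains no points of $X$, and (b) the points of $S_p$ are in general position, then $H$ traverses $S_p$ in a path, which belongs to the list produced by $A_H$ when a congruent copy of $S_p$ is used as the input to $A_H$. -}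

module Defs where

open import Algebra.Bundles using (CommutativeRing)
import Algebra.Definitions.RawMonoid as RawMonoidSum
import Algebra.Properties.Ring as RingProperties
import Algebra.Solver.Ring.NaturalCoefficients.Default as NatSolver
open import Data.Bool.Base using (Bool; if_then_else_)
open import Data.Fin.Base as Fin using (Fin; toℕ)
open import Data.List.Base as List using (List; []; _∷_; _∷ʳ_; map; filter; foldr; lookup; allFin; zip; reverse)
open import Data.List.Membership.Propositional using (_∈_; _∉_)
open import Data.List.Relation.Binary.Permutation.Propositional using (_↭_)
open import Data.List.Relation.Unary.All using (All)
open import Data.List.Relation.Unary.Linked using (Linked)
open import Data.Nat.Base as ℕ using (ℕ; suc)
import Data.Fin.Properties as Fin
import Data.Nat.Properties as ℕ
open import Data.Product.Base using (Σ; ∃; _×_; _,_; proj₁; proj₂)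
open import Data.Sum.Base using (_⊎_; inj₁; inj₂)
open import Data.Vec.Functional using (Vector)
open import Data.Vec.Functional.Relation.Binary.Pointwise using (Pointwise)
open import Function.Base using (_∘_)
open import Level using (0ℓ)
open import Relation.Binary.Bundles using (DecTotalOrder)
open import Relation.Binary.Core using (Rel)
open import Relation.Binary.PropositionalEquality.Core as ≡ using (_≡_)
import Relation.Binary.Reasoning.PartialOrder as PosetReasoning
import Relation.Binary.Reasoning.Setoid as SetoidReasoning
open import Relation.Binary.Structures using (IsDecTotalOrder)
open import Relation.Nullary.Decidable using (yes; no; ⌊_⌋)
open import Relation.Nullary.Negation using (¬_; contradiction)

------------------------------------------------------------------------
-- The real numbers, as a complete ordered field.  These axioms are
-- classically categorical.  The order is decidable, as in the classical
-- reading of the reals.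

record RealNumbers : Set₁ where
  field
    commutativeRing : CommutativeRing 0ℓ 0ℓ

  open CommutativeRing commutativeRing public

  infix 4 _≤_
  field
    _≤_             : Rel Carrier 0ℓ
    isDecTotalOrder : IsDecTotalOrder _≈_ _≤_
    +-monoʳ-≤       : ∀ x {y z} → y ≤ z → x + y ≤ x + z
    *-nonNegative   : ∀ {x y} → 0# ≤ x → 0# ≤ y → 0# ≤ x * y
    1≉0             : ¬ (1# ≈ 0#)
    inverse         : ∀ x → ¬ (x ≈ 0#) → ∃ λ y → x * y ≈ 1#

  UpperBound : (Carrier → Set) → Carrier → Set
  UpperBound P b = ∀ x → P x → x ≤ b

  field
    supremum : (P : Carrier → Set) → ∃ P → ∃ (UpperBound P) →
               ∃ λ s → UpperBound P s × (∀ b → UpperBound P b → s ≤ b)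

  open IsDecTotalOrder isDecTotalOrder public
    using (total; antisym; _≟_; _≤?_)
    renaming (refl to ≤-refl; trans to ≤-trans; reflexive to ≤-reflexive)

  decTotalOrder : DecTotalOrder 0ℓ 0ℓ 0ℓ
  decTotalOrder = record { isDecTotalOrder = isDecTotalOrder }

------------------------------------------------------------------------
-- Square roots of nonnegative reals

module SquareRoot (ℝ : RealNumbers) where
  open RealNumbers ℝ
  open RingProperties ring using (-‿distribˡ-*; -‿distribʳ-*; -‿involutive)
  open NatSolver commutativeSemiring
    using (solve; _:=_; _:+_; _:*_)
  module ≤R = PosetReasoning (DecTotalOrder.poset decTotalOrder)
  module ≈R = SetoidReasoning setoid

  split : ∀ x y → y ≈ x + (y - x)
  split x y = sym (begin
    x + (y - x)    ≈⟨ +-congˡ (+-comm y (- x)) ⟩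
    x + (- x + y)  ≈⟨ +-assoc x (- x) y ⟨
    (x - x) + y    ≈⟨ +-congʳ (-‿inverseʳ x) ⟩
    0# + y         ≈⟨ +-identityˡ y ⟩
    y              ∎)
    where open ≈R

  x≤y⇒0≤y-x : ∀ {x y} → x ≤ y → 0# ≤ y - x
  x≤y⇒0≤y-x {x} {y} x≤y = begin
    0#       ≈⟨ -‿inverseˡ x ⟨
    - x + x  ≤⟨ +-monoʳ-≤ (- x) x≤y ⟩
    - x + y  ≈⟨ +-comm (- x) y ⟩
    y - x    ∎
    where open ≤R

  x≤x+y : ∀ x {y} → 0# ≤ y → x ≤ x + y
  x≤x+y x {y} 0≤y = begin
    x       ≈⟨ +-identityʳ x ⟨
    x + 0#  ≤⟨ +-monoʳ-≤ x 0≤y ⟩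
    x + y   ∎
    where open ≤R

  +-cancelˡ-≤ : ∀ x {y z} → x + y ≤ x + z → y ≤ z
  +-cancelˡ-≤ x {y} {z} le = begin
    y              ≈⟨ lem y ⟨
    - x + (x + y)  ≤⟨ +-monoʳ-≤ (- x) le ⟩
    - x + (x + z)  ≈⟨ lem z ⟩
    z              ∎
    where
    open ≤R
    lem : ∀ w → - x + (x + w) ≈ w
    lem w = trans (sym (+-assoc _ _ _)) (trans (+-congʳ (-‿inverseˡ x)) (+-identityˡ w))

  +-nonNegative : ∀ {x y} → 0# ≤ x → 0# ≤ y → 0# ≤ x + y
  +-nonNegative {x} 0≤x 0≤y = ≤-trans 0≤x (x≤x+y x 0≤y)

  *-monoˡ-≤ : ∀ {x y z} → 0# ≤ z → x ≤ y → z * x ≤ z * y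
  *-monoˡ-≤ {x} {y} {z} 0≤z x≤y = begin
    z * x                ≤⟨ x≤x+y (z * x) (*-nonNegative 0≤z (x≤y⇒0≤y-x x≤y)) ⟩
    z * x + z * (y - x)  ≈⟨ distribˡ z x (y - x) ⟨
    z * (x + (y - x))    ≈⟨ *-congˡ (split x y) ⟨
    z * y                ∎
    where open ≤R

  square-nonNegative : ∀ x → 0# ≤ x * x
  square-nonNegative x with total 0# x
  ... | inj₁ 0≤x = *-nonNegative 0≤x 0≤x
  ... | inj₂ x≤0 = begin
    0#         ≤⟨ *-nonNegative 0≤-x 0≤-x ⟩
    - x * - x  ≈⟨ -‿distribˡ-* x (- x) ⟨
    - (x * - x) ≈⟨ -‿cong (-‿distribʳ-* x x) ⟨
    - - (x * x) ≈⟨ -‿involutive (x * x) ⟩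
    x * x      ∎
    where
    open ≤R
    0≤-x : 0# ≤ - x
    0≤-x = ≤-trans (x≤y⇒0≤y-x x≤0) (≤-reflexive (+-identityˡ (- x)))

  0≤1 : 0# ≤ 1#
  0≤1 = ≤-trans (square-nonNegative 1#) (≤-reflexive (*-identityˡ 1#))

  inverse-nonNegative : ∀ {x y} → 0# ≤ x → x * y ≈ 1# → 0# ≤ y
  inverse-nonNegative {x} {y} 0≤x xy≈1 = begin
    0#           ≤⟨ *-nonNegative 0≤x (square-nonNegative y) ⟩
    x * (y * y)  ≈⟨ *-assoc x y y ⟨
    x * y * y    ≈⟨ *-congʳ xy≈1 ⟩
    1# * y       ≈⟨ *-identityˡ y ⟩
    y            ∎
    where open ≤R

  square-zero : ∀ {x} → x * x ≤ 0# → x ≈ 0#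
  square-zero {x} x²≤0 with x ≟ 0#
  ... | yes x≈0 = x≈0
  ... | no x≉0 with inverse x x≉0
  ...   | y , xy≈1 = begin
    x            ≈⟨ *-identityʳ x ⟨
    x * 1#       ≈⟨ *-congˡ xy≈1 ⟨
    x * (x * y)  ≈⟨ *-assoc x x y ⟨
    x * x * y    ≈⟨ *-congʳ (antisym x²≤0 (square-nonNegative x)) ⟩
    0# * y       ≈⟨ zeroˡ y ⟩
    0#           ∎
    where open ≈R

  square-cancel-≤ : ∀ {x y} → 0# ≤ y → x * x ≤ y * y → x ≤ y
  square-cancel-≤ {x} {y} 0≤y x²≤y² with total x y
  ... | inj₁ x≤y = x≤y
  ... | inj₂ y≤x = ≤-reflexive (trans x≈y+δ (trans (+-congˡ δ≈0) (+-identityʳ y)))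
    where
    open ≤R
    δ : Carrier
    δ = x - y
    0≤δ : 0# ≤ δ
    0≤δ = x≤y⇒0≤y-x y≤x
    x≈y+δ : x ≈ y + δ
    x≈y+δ = split y x
    δ≈0 : δ ≈ 0#
    δ≈0 = square-zero (+-cancelˡ-≤ (y * y) (begin
      y * y + δ * δ                      ≤⟨ x≤x+y _ (*-nonNegative (+-nonNegative 0≤y 0≤y) 0≤δ) ⟩
      (y * y + δ * δ) + (y + y) * δ      ≈⟨ solve 2 (λ y δ → (y :* y :+ δ :* δ) :+ (y :+ y) :* δ
                                              := (y :+ δ) :* (y :+ δ)) refl y δ ⟩
      (y + δ) * (y + δ)                  ≈⟨ *-cong x≈y+δ x≈y+δ ⟨
      x * x                              ≤⟨ x²≤y² ⟩
      y * y                              ≈⟨ +-identityʳ (y * y) ⟨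
      y * y + 0#                         ∎))

  SquareBelow : Carrier → Carrier → Set
  SquareBelow a y = y * y ≤ a

  private
    sup-identity₁ : ∀ a s i → a * (((s + s) * i) * ((s + s) * i)) ≈ a * ((s * s) * ((i + i) * (i + i)))
    sup-identity₁ = solve 3 (λ a s i →
      a :* (((s :+ s) :* i) :* ((s :+ s) :* i)) := a :* ((s :* s) :* ((i :+ i) :* (i :+ i)))) refl

    sup-identity₂ : ∀ a g i → a * ((a + g) * ((i + i) * (i + i))) + (g * i) * (g * i)
                              ≈ (((a + g) + a) * i) * (((a + g) + a) * i)
    sup-identity₂ = solve 3 (λ a g i →
      a :* ((a :+ g) :* ((i :+ i) :* (i :+ i))) :+ (g :* i) :* (g :* i)
      := (((a :+ g) :+ a) :* i) :* (((a :+ g) :+ a) :* i)) refl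

    sup-identity₃ : ∀ s δ → (s + δ) * (s + δ) ≈ s * s + δ * ((s + s) + δ)
    sup-identity₃ = solve 2 (λ s δ → (s :+ δ) :* (s :+ δ) := s :* s :+ δ :* ((s :+ s) :+ δ)) refl

    sup-identity₄ : ∀ u a → u * a + (u * u + (u * a + a * a)) ≈ (u + a) * (u + a)
    sup-identity₄ = solve 2 (λ u a → u :* a :+ (u :* u :+ (u :* a :+ a :* a)) := (u :+ a) :* (u :+ a)) refl

    sup-identity₅ : ∀ g u v e → g + (u + (e + v)) ≈ e + (v + (u + g))
    sup-identity₅ = solve 4 (λ g u v e → g :+ (u :+ (e :+ v)) := e :+ (v :+ (u :+ g))) refl

    sup-identity₆ : ∀ v a e → (v + e) + a ≈ e + (v + a)
    sup-identity₆ = solve 3 (λ v a e → (v :+ e) :+ a := e :+ (v :+ a)) refl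

    sup-identity₇ : ∀ x y z → x * (y * z) ≈ (x * z) * y
    sup-identity₇ = solve 3 (λ x y z → x :* (y :* z) := (x :* z) :* y) refl

  sup-square-≤ : ∀ {a s} → 0# ≤ a → 0# ≤ s →
                 (∀ b → UpperBound (SquareBelow a) b → s ≤ b) → s * s ≤ a
  sup-square-≤ {a} {s} 0≤a 0≤s s-least with total (s * s) a | (s + s) ≟ 0#
  ... | inj₁ le   | _ = le
  ... | inj₂ _    | yes 2s≈0 = ≤-trans (*-monoˡ-≤ 0≤s s≤0) (≤-trans (≤-reflexive (zeroʳ s)) 0≤a)
    where
    s≤0 : s ≤ 0#
    s≤0 = ≤-trans (x≤x+y s 0≤s) (≤-reflexive 2s≈0)
  ... | inj₂ a≤s² | no 2s≉0 with inverse (s + s) 2s≉0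
  ...   | i , 2si≈1 = +-cancelˡ-≤ (s * s) (begin
    s * s + s * s                  ≈⟨ distribˡ s s s ⟨
    s * (s + s)                    ≈⟨ *-comm s (s + s) ⟩
    (s + s) * s                    ≤⟨ *-monoˡ-≤ 0≤2s (s-least t t-upper) ⟩
    (s + s) * t                    ≈⟨ sup-identity₇ (s + s) (s * s + a) i ⟩
    (s + s) * i * (s * s + a)      ≈⟨ *-congʳ 2si≈1 ⟩
    1# * (s * s + a)               ≈⟨ *-identityˡ _ ⟩
    s * s + a                      ∎)
    where
    open ≤R
    0≤2s : 0# ≤ s + s
    0≤2s = +-nonNegative 0≤s 0≤s
    t : Carrier
    t = (s * s + a) * i
    0≤t : 0# ≤ t
    0≤t = *-nonNegative (+-nonNegative (square-nonNegative s) 0≤a) (inverse-nonNegative 0≤2s 2si≈1)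
    g : Carrier
    g = s * s - a
    s²≈a+g : s * s ≈ a + g
    s²≈a+g = split a (s * s)
    a≤t² : a ≤ t * t
    a≤t² = begin
      a                                          ≈⟨ *-identityʳ a ⟨
      a * 1#                                     ≈⟨ *-congˡ (*-identityˡ 1#) ⟨
      a * (1# * 1#)                              ≈⟨ *-congˡ (*-cong 2si≈1 2si≈1) ⟨
      a * (((s + s) * i) * ((s + s) * i))        ≈⟨ sup-identity₁ a s i ⟩
      a * ((s * s) * j²)                         ≈⟨ *-congˡ (*-congʳ s²≈a+g) ⟩
      a * ((a + g) * j²)                         ≤⟨ x≤x+y _ (square-nonNegative (g * i)) ⟩
      a * ((a + g) * j²) + (g * i) * (g * i)     ≈⟨ sup-identity₂ a g i ⟩
      (((a + g) + a) * i) * (((a + g) + a) * i)  ≈⟨ *-cong eq eq ⟨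
      t * t                                      ∎
      where
      j² : Carrier
      j² = (i + i) * (i + i)
      eq : t ≈ ((a + g) + a) * i
      eq = *-congʳ (+-congʳ s²≈a+g)
    t-upper : UpperBound (SquareBelow a) t
    t-upper y y²≤a = square-cancel-≤ 0≤t (≤-trans y²≤a a≤t²)

  ≤-sup-square : ∀ {a s} → 0# ≤ a → 0# ≤ s → UpperBound (SquareBelow a) s → a ≤ s * s
  ≤-sup-square {a} {s} 0≤a 0≤s s-upper with total a (s * s)
  ... | inj₁ le   = le
  ... | inj₂ s²≤a = begin
    a                  ≈⟨ a≈s²+g ⟩
    s * s + g          ≈⟨ +-congˡ g≈cδ ⟩
    s * s + c * δ      ≤⟨ +-monoʳ-≤ (s * s) (*-monoˡ-≤ 0≤c δ≤0) ⟩
    s * s + c * 0#     ≈⟨ +-congˡ (zeroʳ c) ⟩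
    s * s + 0#         ≈⟨ +-identityʳ _ ⟩
    s * s              ∎
    where
    open ≤R
    c g : Carrier
    c = 1# + ((s + s) + a)
    g = a - s * s
    a≈s²+g : a ≈ s * s + g
    a≈s²+g = split (s * s) a
    0≤g : 0# ≤ g
    0≤g = x≤y⇒0≤y-x s²≤a
    0≤2s+a : 0# ≤ (s + s) + a
    0≤2s+a = +-nonNegative (+-nonNegative 0≤s 0≤s) 0≤a
    1≤c : 1# ≤ c
    1≤c = x≤x+y 1# 0≤2s+a
    0≤c : 0# ≤ c
    0≤c = ≤-trans 0≤1 1≤c
    c≉0 : ¬ (c ≈ 0#)
    c≉0 c≈0 = 1≉0 (antisym (≤-trans 1≤c (≤-reflexive c≈0)) 0≤1)
    i : Carrier
    i = proj₁ (inverse c c≉0)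
    ci≈1 : c * i ≈ 1#
    ci≈1 = proj₂ (inverse c c≉0)
    0≤i : 0# ≤ i
    0≤i = inverse-nonNegative 0≤c ci≈1
    δ : Carrier
    δ = i * g
    0≤δ : 0# ≤ δ
    0≤δ = *-nonNegative 0≤i 0≤g
    g≈cδ : g ≈ c * δ
    g≈cδ = trans (sym (*-identityˡ g)) (trans (*-congʳ (sym ci≈1)) (*-assoc c i g))
    g≤c : g ≤ c
    g≤c = begin
      g                              ≤⟨ x≤x+y g (+-nonNegative (square-nonNegative s) (+-nonNegative 0≤1 (+-nonNegative 0≤s 0≤s))) ⟩
      g + (s * s + (1# + (s + s)))   ≈⟨ sup-identity₅ g (s * s) (s + s) 1# ⟩
      1# + ((s + s) + (s * s + g))   ≈⟨ +-congˡ (+-congˡ a≈s²+g) ⟨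
      c                              ∎
    δ≤1 : δ ≤ 1#
    δ≤1 = ≤-trans (*-monoˡ-≤ 0≤i g≤c) (≤-reflexive (trans (*-comm i c) ci≈1))
    2s+δ≤c : (s + s) + δ ≤ c
    2s+δ≤c = begin
      (s + s) + δ        ≤⟨ +-monoʳ-≤ (s + s) δ≤1 ⟩
      (s + s) + 1#       ≤⟨ x≤x+y _ 0≤a ⟩
      (s + s) + 1# + a   ≈⟨ sup-identity₆ (s + s) a 1# ⟩
      c                  ∎
    s+δ∈Below : SquareBelow a (s + δ)
    s+δ∈Below = begin
      (s + δ) * (s + δ)              ≈⟨ sup-identity₃ s δ ⟩
      s * s + δ * ((s + s) + δ)      ≤⟨ +-monoʳ-≤ (s * s) (*-monoˡ-≤ 0≤δ 2s+δ≤c) ⟩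
      s * s + δ * c                  ≈⟨ +-congˡ (*-comm δ c) ⟩
      s * s + c * δ                  ≈⟨ +-congˡ g≈cδ ⟨
      s * s + g                      ≈⟨ a≈s²+g ⟨
      a                              ∎
    δ≤0 : δ ≤ 0#
    δ≤0 = +-cancelˡ-≤ s (≤-trans (s-upper (s + δ) s+δ∈Below) (≤-reflexive (sym (+-identityʳ s))))

  abstract
    sqrt : ∀ a → 0# ≤ a → ∃ λ s → 0# ≤ s × s * s ≈ a
    sqrt a 0≤a = s , 0≤s , antisym (sup-square-≤ 0≤a 0≤s s-least) (≤-sup-square 0≤a 0≤s s-upper)
      where
      open ≤R

      0∈Below : SquareBelow a 0#
      0∈Below = ≤-trans (≤-reflexive (zeroˡ 0#)) 0≤a

      bounded : UpperBound (SquareBelow a) (1# + a)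
      bounded y y²≤a = square-cancel-≤ (+-nonNegative 0≤1 0≤a) (begin
        y * y                                  ≤⟨ y²≤a ⟩
        a                                      ≈⟨ *-identityˡ a ⟨
        1# * a                                 ≤⟨ x≤x+y (1# * a) (+-nonNegative (square-nonNegative 1#)
                                                    (+-nonNegative (*-nonNegative 0≤1 0≤a) (square-nonNegative a))) ⟩
        1# * a + (1# * 1# + (1# * a + a * a))  ≈⟨ sup-identity₄ 1# a ⟩
        (1# + a) * (1# + a)                    ∎)

      lub : ∃ λ s → UpperBound (SquareBelow a) s × (∀ b → UpperBound (SquareBelow a) b → s ≤ b)
      lub = supremum (SquareBelow a) (0# , 0∈Below) (1# + a , bounded)

      s : Carrier
      s = proj₁ lub

      s-upper : UpperBound (SquareBelow a) s
      s-upper = proj₁ (proj₂ lub)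

      s-least : ∀ b → UpperBound (SquareBelow a) b → s ≤ b
      s-least = proj₂ (proj₂ lub)

      0≤s : 0# ≤ s
      0≤s = s-upper 0# 0∈Below

------------------------------------------------------------------------
-- Algorithms with a blackbox comparing sums of distances.
--
-- A program is written once and for all, for every number m of points.
-- It sees the points only through the blackbox, which says whether one
-- sum of distances is at most another; a sum is given as a list of pairs
-- of points.  Registers and memory cells hold natural numbers, which
-- grow by at most one per step, so that counting steps agrees with
-- Turing machine time up to a polynomial.

Register : Set
Register = ℕ

infixr 5 _⨟_

data Program : Set where
  skip                 : Program
  set                  : Register → ℕ → Program         -- x := n
  copy                 : Register → Register → Program  -- x := y
  inc                  : Register → Program             -- x := x + 1
  load                 : Register → Register → Program  -- x := memory[y]
  store                : Register → Register → Program  -- memory[x] := y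
  addLeft addRight     : Register → Register → Program  -- put the pair (x , y) into a sum
  compare              : Register → Program             -- x := 1 if left sum ≤ right sum, else 0; clear both sums
  visit                : Register → Program             -- append the point x to the current path
  finish               : Program                        -- output the current path and start an empty one
  _⨟_                  : Program → Program → Program
  ifLess               : Register → Register → Program → Program → Program  -- if x < y then … else …
  whileLess            : Register → Register → Program → Program            -- while x < y do …

PairList : ℕ → Set
PairList m = List (Fin m × Fin m)

Blackbox : ℕ → Set
Blackbox m = PairList m → PairList m → Bool

record State (m : ℕ) : Set where
  constructor state
  field
    register   : ℕ → ℕ
    memory     : ℕ → ℕ
    left right : PairList m
    path       : List (Fin m)
    output     : List (List (Fin m))

infixl 6 _[_↦_]

_[_↦_] : (ℕ → ℕ) → ℕ → ℕ → (ℕ → ℕ)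
(f [ k ↦ v ]) j = if ⌊ j ℕ.≟ k ⌋ then v else f j

-- The only input besides the blackbox is the number of points, in register 0.
initial : ∀ m → State m
initial m = state ((λ _ → 0) [ 0 ↦ m ]) (λ _ → 0) [] [] [] []

-- p ⊢ σ ⇓ σ′ after t : with blackbox bb, p started in σ halts in σ′ after
-- exactly t steps.  Naming a point that does not exist is an error, for
-- which there is no rule.
module Semantics {m : ℕ} (bb : Blackbox m) where
  open State

  infix 3 _⊢_⇓_after_

  data _⊢_⇓_after_ : Program → State m → State m → ℕ → Set where

    skip : ∀ {σ} → skip ⊢ σ ⇓ σ after 1

    set : ∀ {x n σ} →
      set x n ⊢ σ ⇓ record σ { register = register σ [ x ↦ n ] } after 1

    copy : ∀ {x y σ} →
      copy x y ⊢ σ ⇓ record σ { register = register σ [ x ↦ register σ y ] } after 1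

    inc : ∀ {x σ} →
      inc x ⊢ σ ⇓ record σ { register = register σ [ x ↦ suc (register σ x) ] } after 1

    load : ∀ {x y σ} →
      load x y ⊢ σ ⇓ record σ { register = register σ [ x ↦ memory σ (register σ y) ] } after 1

    store : ∀ {x y σ} →
      store x y ⊢ σ ⇓ record σ { memory = memory σ [ register σ x ↦ register σ y ] } after 1

    addLeft : ∀ {x y σ} {i j : Fin m} → register σ x ≡ toℕ i → register σ y ≡ toℕ j →
      addLeft x y ⊢ σ ⇓ record σ { left = (i , j) ∷ left σ } after 1

    addRight : ∀ {x y σ} {i j : Fin m} → register σ x ≡ toℕ i → register σ y ≡ toℕ j →
      addRight x y ⊢ σ ⇓ record σ { right = (i , j) ∷ right σ } after 1

    compare : ∀ {x σ} →
      compare x ⊢ σ ⇓ record σ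
        { register = register σ [ x ↦ (if bb (left σ) (right σ) then 1 else 0) ]
        ; left = [] ; right = [] } after 1

    visit : ∀ {x σ} {i : Fin m} → register σ x ≡ toℕ i →
      visit x ⊢ σ ⇓ record σ { path = path σ ∷ʳ i } after 1

    finish : ∀ {σ} →
      finish ⊢ σ ⇓ record σ { path = [] ; output = output σ ∷ʳ path σ } after 1

    _⨟_ : ∀ {p q σ σ′ σ″ t u} →
      p ⊢ σ ⇓ σ′ after t → q ⊢ σ′ ⇓ σ″ after u → (p ⨟ q) ⊢ σ ⇓ σ″ after (t ℕ.+ u)

    if-true : ∀ {x y p q σ σ′ t} → register σ x ℕ.< register σ y →
      p ⊢ σ ⇓ σ′ after t → (ifLess x y p q) ⊢ σ ⇓ σ′ after suc t

    if-false : ∀ {x y p q σ σ′ t} → ¬ (register σ x ℕ.< register σ y) →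
      q ⊢ σ ⇓ σ′ after t → (ifLess x y p q) ⊢ σ ⇓ σ′ after suc t

    while-done : ∀ {x y p σ} → ¬ (register σ x ℕ.< register σ y) →
      (whileLess x y p) ⊢ σ ⇓ σ after 1

    while-step : ∀ {x y p σ σ′ σ″ t u} → register σ x ℕ.< register σ y →
      p ⊢ σ ⇓ σ′ after t → (whileLess x y p) ⊢ σ′ ⇓ σ″ after u →
      (whileLess x y p) ⊢ σ ⇓ σ″ after suc (t ℕ.+ u)

------------------------------------------------------------------------
-- Paths and tours on points labelled by Fin n

-- A path is listed in order; s lists a set of points without repetition.
IsHamiltonPathThrough : ∀ {n} → List (Fin n) → List (Fin n) → Set
IsHamiltonPathThrough s P = P ↭ s

-- The list is the cyclic order of the points on the tour.
IsTour : ∀ {n} → List (Fin n) → Set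
IsTour {n} T = T ↭ allFin n

cyclicPairs : ∀ {A : Set} → List A → List (A × A)
cyclicPairs []       = []
cyclicPairs (x ∷ xs) = zip (x ∷ xs) (xs ∷ʳ x)

-- Edges of the tour are undirected.
TourEdge : ∀ {n} → List (Fin n) → Fin n → Fin n → Set
TourEdge T i j = (i , j) ∈ cyclicPairs T ⊎ (j , i) ∈ cyclicPairs T

------------------------------------------------------------------------
-- Euclidean geometry

data Sign₀ : Set where
  0ˢ +ˢ -ˢ : Sign₀

module Euclidean (ℝ : RealNumbers) where
  open RealNumbers ℝ
  open SquareRoot ℝ using (sqrt; square-nonNegative; +-nonNegative)
  open RawMonoidSum +-rawMonoid using (sum)

  Point : ℕ → Set
  Point d = Vector Carrier d

  infix 4 _≋_
  _≋_ : ∀ {d} → Point d → Point d → Set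
  _≋_ = Pointwise _≈_

  squaredDist : ∀ {d} → Point d → Point d → Carrier
  squaredDist p q = sum (λ k → (p k - q k) * (p k - q k))

  sum-nonNegative : ∀ {d} (v : Vector Carrier d) → (∀ k → 0# ≤ v k) → 0# ≤ sum v
  sum-nonNegative {ℕ.zero} v 0≤v = ≤-refl
  sum-nonNegative {suc d}  v 0≤v =
    +-nonNegative (0≤v Fin.zero) (sum-nonNegative (v ∘ Fin.suc) (0≤v ∘ Fin.suc))

  dist : ∀ {d} → Point d → Point d → Carrier
  dist p q = proj₁ (sqrt (squaredDist p q) (sum-nonNegative _ λ k → square-nonNegative (p k - q k)))

  Ball : ∀ {d} → Point d → Carrier → Point d → Set
  Ball p r q = dist p q ≤ r

  IsIsometry : ∀ {d} → (Point d → Point d) → Set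
  IsIsometry φ = ∀ p q → dist (φ p) (φ q) ≈ dist p q

  ⟦_⟧ : Sign₀ → Carrier
  ⟦ 0ˢ ⟧ = 0#
  ⟦ +ˢ ⟧ = 1#
  ⟦ -ˢ ⟧ = - 1#

  signedDistanceSum : ∀ {d m} → (Fin m → Point d) → (Fin m → Fin m → Sign₀) → Carrier
  signedDistanceSum y ξ =
    sum λ i → sum λ j → if ⌊ i Fin.<? j ⌋ then ⟦ ξ i j ⟧ * dist (y i) (y j) else 0#

  GeneralPosition : ∀ {d m} → (Fin m → Point d) → Set
  GeneralPosition {m = m} y = ∀ (ξ : Fin m → Fin m → Sign₀) →
    (∃ λ i → ∃ λ j → i Fin.< j × ¬ (ξ i j ≡ 0ˢ)) → ¬ (signedDistanceSum y ξ ≈ 0#)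

  distanceMatrix : ∀ {d m} → (Fin m → Point d) → Fin m → Fin m → Carrier
  distanceMatrix y i j = dist (y i) (y j)

  blackbox : ∀ {m} → (Fin m → Fin m → Carrier) → Blackbox m
  blackbox D l r = ⌊ sumOver l ≤? sumOver r ⌋
    where
    sumOver = foldr (λ (i , j) acc → D i j + acc) 0#

  record PointSet (d : ℕ) : Set where
    field
      size     : ℕ
      point    : Fin size → Point d
      distinct : ∀ {i j} → point i ≋ point j → i ≡ j

  open PointSet public

  ----------------------------------------------------------------------
  -- Path-finding heuristics

  HaltsWith : ∀ {d m} → Program → (Fin m → Point d) → List (List (Fin m)) → ℕ → Set
  HaltsWith {m = m} p y Ps t =
    ∃ λ σ → p ⊢ initial m ⇓ σ after t × State.output σ ≡ Ps
    where open Semantics (blackbox (distanceMatrix y))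

  record PathFindingHeuristic (d : ℕ) : Set where
    field
      program         : Program
      coeff degree    : ℕ
      polynomialTime  : ∀ {m} (y : Fin m → Point d) → GeneralPosition y →
        ∃ λ Ps → ∃ λ t → HaltsWith program y Ps t
                       × t ℕ.≤ coeff ℕ.* m ℕ.^ degree ℕ.+ coeff
                       × All (IsHamiltonPathThrough (allFin m)) Ps

  -- Ps is the list produced on input y; the semantics is deterministic.
  Produces : ∀ {d m} → PathFindingHeuristic d → (Fin m → Point d) → List (List (Fin m)) → Set
  Produces A y Ps = ∃ (HaltsWith (PathFindingHeuristic.program A) y Ps)

  ----------------------------------------------------------------------
  -- TSP heuristics

  -- A heuristic whose behaviour is not fully specified is the relation
  -- between inputs and the tours it may return.
  record TSPHeuristic (d : ℕ) : Set₁ where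
    field
      Returns : (X : PointSet d) → List (Fin (size X)) → Set
      isTour  : ∀ {X T} → Returns X T → IsTour T

  open TSPHeuristic public

  -- The path grown by nearest neighbor, most recently added point first.
  data Grows {d} (X : PointSet d) : List (Fin (size X)) → Set where
    start : ∀ x₀ → Grows X (x₀ ∷ [])
    step  : ∀ {c path next} → Grows X (c ∷ path) → next ∉ c ∷ path →
            (∀ z → z ∉ c ∷ path → dist (point X c) (point X next) ≤ dist (point X c) (point X z)) →
            Grows X (next ∷ c ∷ path)

  NearestNeighbor : ∀ {d} → TSPHeuristic d
  NearestNeighbor = record
    { Returns = λ X T → Grows X (reverse T) × IsTour T
    ; isTour  = proj₂
    }

  ----------------------------------------------------------------------
  -- Scalefree heuristics

  pointsInUnitBall : ∀ {d} (X : PointSet d) → Point d → List (Fin (size X))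
  pointsInUnitBall X p = filter (λ i → dist p (point X i) ≤? 1#) (allFin (size X))

  EmptyAnnulus : ∀ {d} → PointSet d → Point d → Carrier → Set
  EmptyAnnulus X p R = ∀ i → ¬ (Ball p R (point X i) × ¬ Ball p 1# (point X i))

  -- y is a congruent copy, in any order, of the points of X listed in s;
  -- y k is the copy of the point e k.
  CongruentCopy : ∀ {d m} (X : PointSet d) → List (Fin (size X)) →
                  (Fin m → Point d) → (Fin m → Fin (size X)) → Set
  CongruentCopy X s y e = List.tabulate e ↭ s ×
    (∃ λ φ → IsIsometry φ × (∀ k → y k ≋ φ (point X (e k))))

  TraversesIn : ∀ {n} → List (Fin n) → List (Fin n) → List (Fin n) → Set
  TraversesIn T s P = IsHamiltonPathThrough s P × Linked (TourEdge T) P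

  Scalefree : ∀ {d} → TSPHeuristic d → Set
  Scalefree {d} H =
    Σ Carrier λ R → Σ (PathFindingHeuristic d) λ A →
    ∀ (X : PointSet d) T → Returns H X T → ∀ (p : Point d) →
    let S = pointsInUnitBall X p in
    EmptyAnnulus X p R → GeneralPosition (point X ∘ lookup S) →
    ∃ λ P → TraversesIn T S P ×
      (∀ {m} (y : Fin m → Point d) e → CongruentCopy X S y e →
        ∃ λ Ps → Produces A y Ps × P ∈ map (map e) Ps)

module Submission where

import Algebra.Properties.AbelianGroup as AbelianGroupProperties
import Algebra.Properties.CommutativeMonoid.Sum as Sum
import Algebra.Properties.Ring as RingProperties
import Algebra.Solver.Ring.NaturalCoefficients.Default as NatSolver
open import Data.Bool.Base using (true; false; if_then_else_)
open import Data.Fin.Base as Fin using (Fin; toℕ; fromℕ<)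
import Data.Fin.Properties as Fin
open import Data.List.Base using (List; []; _∷_; _++_; _∷ʳ_; map; length; lookup; tabulate; allFin; zip; reverse)
import Data.List.Membership.DecPropositional as DecMembership
open import Data.List.Membership.Propositional using (_∈_; _∉_)
open import Data.List.Membership.Propositional.Properties
  using (∈-map⁺; ∈-map⁻; ∈-allFin; ∈-lookup; ∈-tabulate⁺; ∈-tabulate⁻; ∈-filter⁺; ∈-filter⁻)
open import Data.List.Membership.Propositional.Properties.WithK using (unique∧set⇒bag)
open import Data.List.Membership.Setoid.Properties using (index-injective)
open import Data.List.Properties
  using (unfold-reverse; reverse-++; reverse-involutive; reverse-map; length-map; length-tabulate)
open import Data.List.Relation.Binary.BagAndSetEquality using (∼bag⇒↭)
open import Data.List.Relation.Binary.Permutation.Propositional using (_↭_; ↭-trans; ↭-sym; ↭⇒↭ₛ)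
open import Data.List.Relation.Binary.Permutation.Propositional.Properties using (↭-reverse; ↭-length; ∈-resp-↭)
open import Data.List.Relation.Binary.Permutation.Setoid.Properties using (Unique-resp-↭)
open import Data.List.Relation.Unary.All as All using (All; []; _∷_)
import Data.List.Relation.Unary.All.Properties as All
open import Data.List.Relation.Unary.AllPairs using ([]; _∷_)
open import Data.List.Relation.Unary.Any as Any using (here; there)
open import Data.List.Relation.Unary.Any.Properties using (lookup-index; ++⁺ˡ; ++⁺ʳ; ++⁻)
open import Data.List.Relation.Unary.Linked as Linked using (Linked; []; [-]; _∷_)
open import Data.List.Relation.Unary.Unique.Propositional using (Unique)
open import Data.List.Relation.Unary.Unique.Propositional.Properties using (allFin⁺; filter⁺)
open import Data.Nat.Base as ℕ using (ℕ; zero; suc; z≤n; s≤s)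
import Data.Nat.Properties as ℕ
open import Data.Nat.Solver using (module +-*-Solver)
open import Data.Product.Base using (∃; _×_; _,_; proj₁; proj₂)
open import Data.Product.Properties using (≡-dec)
open import Data.Sum.Base using (_⊎_; inj₁; inj₂; [_,_]′)
open import Data.Unit.Base using (⊤; tt)
open import Function.Base using (_∘_)
open import Function.Bundles using (mk⇔)
open import Level using (0ℓ)
open import Relation.Binary.Core using (Rel)
open import Relation.Binary.Definitions using (DecidableEquality; tri<; tri≈; tri>)
open import Relation.Binary.PropositionalEquality as ≡ using (_≡_; _≢_; refl; cong; subst)
open import Relation.Nullary.Decidable using (Dec; yes; no; does; ⌊_⌋; dec-true; dec-false)
open import Relation.Nullary.Negation using (¬_; contradiction)
open import Relation.Unary using (Decidable)
open import Defs

-- With R = 4, every point of S_p is nearer to S_p than to the rest of X, so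
-- once the growing path enters S_p it stays there until S_p is exhausted,
-- and it never returns.  The traversal of S_p is thus itself a nearest
-- neighbor path; by general position it involves no ties, so it depends only
-- on its first point and on comparisons between distances within S_p.  The
-- heuristic A_H outputs the nearest neighbor path from each starting point.

-- Lists

-- The stretch of the tour inside the ball and the program's output on a copy live on different
-- index sets. `Greedy` is therefore stated for an arbitrary set and an arbitrary nearness relation,
-- and the output is carried into `X` along `e`. Two greedy paths with the same start and the same
-- length are equal once ties are excluded; this is where general position enters.
--
-- Because the ball is entered at most once, its points are consecutive in the list of the tour and
-- never split between the two ends of that list, so a path that starts or ends inside the ball fits
-- the same pattern. An empty ball is traversed by `[]`, and the program must output an empty path
-- when there are no points so that `[]` belongs to its list.

module _ {A : Set} where

  lookup-injective : ∀ {xs : List A} → Unique xs → ∀ {i j} → lookup xs i ≡ lookup xs j → i ≡ j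
  lookup-injective {x ∷ xs} (_ ∷ _)   {Fin.zero}  {Fin.zero}  _  = refl
  lookup-injective {x ∷ xs} (x≢ ∷ _)  {Fin.zero}  {Fin.suc j} eq = contradiction eq (All.lookup x≢ (∈-lookup j))
  lookup-injective {x ∷ xs} (x≢ ∷ _)  {Fin.suc i} {Fin.zero}  eq = contradiction (≡.sym eq) (All.lookup x≢ (∈-lookup i))
  lookup-injective {x ∷ xs} (_ ∷ xs!) {Fin.suc i} {Fin.suc j} eq = cong Fin.suc (lookup-injective xs! eq)

  unique-tabulate⇒injective : ∀ {n} {f : Fin n → A} → Unique (tabulate f) → ∀ {i j} → f i ≡ f j → i ≡ j
  unique-tabulate⇒injective (_ ∷ _)   {Fin.zero}  {Fin.zero}  _  = refl
  unique-tabulate⇒injective (x≢ ∷ _)  {Fin.zero}  {Fin.suc j} eq = contradiction eq (All.lookup x≢ (∈-tabulate⁺ j))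
  unique-tabulate⇒injective (x≢ ∷ _)  {Fin.suc i} {Fin.zero}  eq = contradiction (≡.sym eq) (All.lookup x≢ (∈-tabulate⁺ i))
  unique-tabulate⇒injective (_ ∷ f!)  {Fin.suc i} {Fin.suc j} eq = cong Fin.suc (unique-tabulate⇒injective f! eq)

  unique∧set⇒↭ : ∀ {xs ys : List A} → Unique xs → Unique ys →
                 (∀ {z} → z ∈ xs → z ∈ ys) → (∀ {z} → z ∈ ys → z ∈ xs) → xs ↭ ys
  unique∧set⇒↭ xs! ys! xs⊆ys ys⊆xs = ∼bag⇒↭ (unique∧set⇒bag xs! ys! (mk⇔ xs⊆ys ys⊆xs))

  ++⁻ˡ-linked : ∀ {R : Rel A 0ℓ} xs {ys} → Linked R (xs ++ ys) → Linked R xs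
  ++⁻ˡ-linked []           _       = []
  ++⁻ˡ-linked (x ∷ [])     _       = [-]
  ++⁻ˡ-linked (x ∷ y ∷ xs) (r ∷ l) = r ∷ ++⁻ˡ-linked (y ∷ xs) l

  ++⁻ʳ-linked : ∀ {R : Rel A 0ℓ} xs {ys} → Linked R (xs ++ ys) → Linked R ys
  ++⁻ʳ-linked []       l = l
  ++⁻ʳ-linked (x ∷ xs) l = ++⁻ʳ-linked xs (Linked.tail l)

  linked-cyclicPairs : ∀ xs → Linked (λ i j → (i , j) ∈ cyclicPairs xs) xs
  linked-cyclicPairs []       = []
  linked-cyclicPairs (x ∷ xs) = linked-zip x x xs
    where
    -- The point `y` that closes the cycle is kept apart from the head `x`, since the recursion
    -- replaces the head but not the closing point.
    linked-zip : ∀ (y x : A) xs → Linked (λ i j → (i , j) ∈ zip (x ∷ xs) (xs ∷ʳ y)) (x ∷ xs)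
    linked-zip y x []        = [-]
    linked-zip y x (x′ ∷ xs) = here refl ∷ Linked.map there (linked-zip y x′ xs)

unique⇒length-≤ : ∀ {n} {xs : List (Fin n)} → Unique xs → length xs ℕ.≤ n
unique⇒length-≤ {n} {xs} xs! = Fin.injective⇒≤ {f = lookup xs} (lookup-injective xs!)

-- Pigeonhole: different points occur at different positions, so the choice of a position for each
-- point is injective.
covering⇒length-≥ : ∀ {n} {xs : List (Fin n)} → (∀ i → i ∈ xs) → n ℕ.≤ length xs
covering⇒length-≥ {n} all∈ = Fin.injective⇒≤ {f = Any.index ∘ all∈}
  λ {i} {j} → index-injective (≡.setoid (Fin n)) (all∈ i) (all∈ j)

∉⇒unique-∷ : ∀ {A : Set} {x : A} {xs} → x ∉ xs → Unique xs → Unique (x ∷ xs)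
∉⇒unique-∷ {xs = xs} x∉xs xs! = All.tabulate (λ z∈xs x≡z → x∉xs (subst (_∈ xs) (≡.sym x≡z) z∈xs)) ∷ xs!

-- A point missing from `xs` could be put in front of it, giving a list of `n + 1` different
-- elements of `Fin n`.
unique∧length⇒↭allFin : ∀ {n} {xs : List (Fin n)} → Unique xs → length xs ≡ n → xs ↭ allFin n
unique∧length⇒↭allFin {n} {xs} xs! length≡n = unique∧set⇒↭ xs! (allFin⁺ n) (λ _ → ∈-allFin _) λ {i} _ → covers i
  where
  open DecMembership (Fin._≟_ {n}) using (_∈?_)
  covers : ∀ i → i ∈ xs
  covers i with i ∈? xs
  ... | yes i∈xs = i∈xs
  ... | no  i∉xs = contradiction
    (subst (λ k → suc k ℕ.≤ n) length≡n (unique⇒length-≤ (∉⇒unique-∷ i∉xs xs!)))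
    (ℕ.<-irrefl refl)

-- Greedy paths

-- The last visited point comes first; Nearer c i j says that i is at least as near to c as j.
data Greedy {A : Set} (S : A → Set) (Nearer : A → Rel A 0ℓ) (x : A) : List A → Set where
  start : S x → Greedy S Nearer x (x ∷ [])
  step  : ∀ {next c path} → Greedy S Nearer x (c ∷ path) → S next → next ∉ c ∷ path →
          (∀ {z} → S z → z ∉ c ∷ path → Nearer c next z) → Greedy S Nearer x (next ∷ c ∷ path)

module _ {A : Set} {S : A → Set} {Nearer : A → Rel A 0ℓ} where

  greedy⇒unique : ∀ {x path} → Greedy S Nearer x path → Unique path
  greedy⇒unique (start _)       = [] ∷ []
  greedy⇒unique (step g _ n∉ _) = ∉⇒unique-∷ n∉ (greedy⇒unique g)

  greedy⇒all : ∀ {x path} → Greedy S Nearer x path → All S path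
  greedy⇒all (start Sx)      = Sx ∷ []
  greedy⇒all (step g Sn _ _) = Sn ∷ greedy⇒all g

  greedy⇒start : ∀ {x path} → Greedy S Nearer x path → S x
  greedy⇒start (start Sx)     = Sx
  greedy⇒start (step g _ _ _) = greedy⇒start g

  -- By induction the tails agree. Each head was then available when the other was chosen, so each
  -- is at least as near to `c` as the other. Antisymmetry is asked for points other than `c`
  -- because general position speaks of distances between different points.
  greedy-deterministic :
    (∀ {c i j} → S c → S i → S j → i ≢ c → j ≢ c → Nearer c i j → Nearer c j i → i ≡ j) →
    ∀ {x path path′} → Greedy S Nearer x path → Greedy S Nearer x path′ →
    length path ≡ length path′ → path ≡ path′
  greedy-deterministic antisym (start _) (start _) _ = refl
  greedy-deterministic antisym (step g Si i∉ i-nearest) (step g′ Sj j∉ j-nearest) eq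
    with refl ← greedy-deterministic antisym g g′ (ℕ.suc-injective eq)
    = cong (_∷ _) (antisym (All.head (greedy⇒all g)) Si Sj (i∉ ∘ here) (j∉ ∘ here)
                     (i-nearest Sj j∉) (j-nearest Si i∉))

-- A nearest choice competes with all of `S′`, so every competitor must be the image of one in `S`.
-- Injectivity keeps an unvisited point unvisited after mapping.
greedy-map : ∀ {A B : Set} {S : A → Set} {S′ : B → Set} {Nearer : A → Rel A 0ℓ} {Nearer′ : B → Rel B 0ℓ}
  {f : A → B} → (∀ {i j} → f i ≡ f j → i ≡ j) →
  (∀ {i} → S i → S′ (f i)) → (∀ {b} → S′ b → ∃ λ a → S a × f a ≡ b) →
  (∀ {c i j} → Nearer c i j → Nearer′ (f c) (f i) (f j)) →
  ∀ {x path} → Greedy S Nearer x path → Greedy S′ Nearer′ (f x) (map f path)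
greedy-map {S = S} {S′} {Nearer} {Nearer′} {f} injective preserves onto nearer = go
  where
  map-∉ : ∀ {i path} → i ∉ path → f i ∉ map f path
  map-∉ i∉ fi∈ with j , j∈ , fi≡fj ← ∈-map⁻ f fi∈ with refl ← injective fi≡fj = i∉ j∈

  go : ∀ {x path} → Greedy S Nearer x path → Greedy S′ Nearer′ (f x) (map f path)
  go (start Sx) = start (preserves Sx)
  go (step {next} {c} {path} g Sn n∉ nearest) = step (go g) (preserves Sn) (map-∉ n∉) nearest′
    where
    nearest′ : ∀ {z} → S′ z → z ∉ map f (c ∷ path) → Nearer′ (f c) (f next) z
    nearest′ S′z z∉ with a , Sa , refl ← onto S′z = nearer (nearest Sa (z∉ ∘ ∈-map⁺ f))

module _ {A : Set} (_≟_ : DecidableEquality A) {S : A → Set} (S? : Decidable S) {Nearer : A → Rel A 0ℓ}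
  (isolated : ∀ {s s′ z} → S s → S s′ → ¬ S z → ¬ Nearer s z s′) where

  open DecMembership _≟_ using (_∈?_)

  -- The invariant of the growing path, newest point first. In `inside`, knowing that `B` avoids `S`
  -- makes every point of `S` outside `Q` unvisited, so a step that is nearest among all unvisited
  -- points is also nearest within `S`.
  data Progress (path : List A) : Set where
    before : All (¬_ ∘ S) path → Progress path
    inside : ∀ {x} Q B → path ≡ Q ++ B → Greedy S Nearer x Q → All (¬_ ∘ S) B → Progress path
    after  : ∀ {x} P Q B → path ≡ P ++ Q ++ B → Greedy S Nearer x Q → (∀ {z} → S z → z ∈ Q) → Progress path

  ∈-prefix : ∀ {z} Q {B} → All (¬_ ∘ S) B → S z → z ∈ Q ++ B → z ∈ Q
  ∈-prefix Q ∉S Sz z∈ with ++⁻ Q z∈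
  ... | inj₁ z∈Q = z∈Q
  ... | inj₂ z∈B = contradiction Sz (All.lookup ∉S z∈B)

  progress : ∀ {x path} → Greedy (λ _ → ⊤) Nearer x path → Progress path
  progress {x} (start _) with S? x
  ... | yes Sx = inside _ [] refl (start Sx) []
  ... | no ¬Sx = before (¬Sx ∷ [])
  progress (step {next} {c} {path} g _ n∉ nearest) with progress g | S? next
  ... | before ∉S | yes Sn = inside (next ∷ []) (c ∷ path) refl (start Sn) ∉S
  ... | before ∉S | no ¬Sn = before (¬Sn ∷ ∉S)
  ... | after P Q B eq greedy full | yes Sn =
    contradiction (subst (next ∈_) (≡.sym eq) (++⁺ʳ P (++⁺ˡ (full Sn)))) n∉
  ... | after P Q B eq greedy full | no _ = after (next ∷ P) Q B (cong (next ∷_) eq) greedy full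
  ... | inside (_ ∷ Q) B refl greedy ∉S | yes Sn = inside (next ∷ c ∷ Q) B refl
    (step greedy Sn (n∉ ∘ ++⁺ˡ) λ Sz z∉ → nearest tt (z∉ ∘ ∈-prefix (c ∷ Q) ∉S Sz)) ∉S
  ... | inside (_ ∷ Q) B refl greedy ∉S | no ¬Sn = after (next ∷ []) (c ∷ Q) B refl greedy full
    where
    full : ∀ {z} → S z → z ∈ c ∷ Q
    -- A point of `S` still unvisited was a competitor when `next`, outside `S`, was chosen;
    -- `isolated` says that it would have been strictly preferred.
    full {z} Sz with z ∈? (c ∷ Q)
    ... | yes z∈ = z∈
    ... | no  z∉ = contradiction (nearest tt (z∉ ∘ ∈-prefix (c ∷ Q) ∉S Sz))
                     (isolated (All.head (greedy⇒all greedy)) Sz ¬Sn)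

  greedy-traverses : ∀ {x path} → Greedy (λ _ → ⊤) Nearer x path → (∀ z → z ∈ path) →
    (∀ z → ¬ S z) ⊎
    ∃ λ P → ∃ λ Q → ∃ λ B → ∃ λ y → path ≡ P ++ Q ++ B × Greedy S Nearer y Q × (∀ {z} → S z → z ∈ Q)
  greedy-traverses g covers with progress g
  ... | before ∉S                  = inj₁ λ z → All.lookup ∉S (covers z)
  ... | after P Q B eq greedy full = inj₂ (P , Q , B , _ , eq , greedy , full)
  ... | inside Q B refl greedy ∉S  =
    inj₂ ([] , Q , B , _ , refl , greedy , λ {z} Sz → ∈-prefix Q ∉S Sz (covers z))

-- The program

points origin mark current best candidate visited answer nought : Register
points    = 0
origin    = 1
mark      = 2
current   = 3
best      = 4
candidate = 5
visited   = 6
answer    = 7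
nought    = 8

-- During the run that starts at the point s, the mark s + 1 in a memory
-- cell says that the point has been visited, so no clearing is needed
-- between runs.  While no candidate is known, best holds the number of points.
replaceIfNearer examine consider scan advance runFrom nearestNeighborProgram : Program
replaceIfNearer =
  addLeft current candidate ⨟ addRight current best ⨟ compare answer ⨟
  -- `nought` always holds 0, so this tests whether the blackbox answered 1.
  ifLess nought answer (copy best candidate) skip
examine = ifLess answer mark (ifLess best points replaceIfNearer (copy best candidate)) skip
consider = load answer candidate ⨟ examine ⨟ inc candidate
scan = copy best points ⨟ set candidate 0 ⨟ whileLess candidate points consider
advance = copy current best ⨟ visit current ⨟ store current mark ⨟ scan ⨟ inc visited
runFrom =
  -- With the origin preloaded into `best`, the first round of `advance` visits the starting point.
  copy mark origin ⨟ inc mark ⨟ copy best origin ⨟ set visited 0 ⨟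
  whileLess visited points advance ⨟ finish ⨟ inc origin
-- Without points the loop outputs nothing, and the last `finish` supplies the empty path.
nearestNeighborProgram = whileLess origin points runFrom ⨟ ifLess nought points skip finish

-- Updates of registers and memory

update-≡ : ∀ (f : ℕ → ℕ) {k v j} → j ≡ k → (f [ k ↦ v ]) j ≡ v
update-≡ f {k} {v} {j} j≡k with j ℕ.≟ k
... | yes _  = refl
... | no j≢k = contradiction j≡k j≢k

update-≢ : ∀ (f : ℕ → ℕ) {k v j} → j ≢ k → (f [ k ↦ v ]) j ≡ f j
update-≢ f {k} {v} {j} j≢k with j ℕ.≟ k
... | yes j≡k = contradiction j≡k j≢k
... | no _    = refl

m+1+n≡o⇒m<o : ∀ {m n o} → m ℕ.+ suc n ≡ o → m ℕ.< o
m+1+n≡o⇒m<o {m} refl = ℕ.m<m+n m ℕ.z<s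

-- Hoare triples with time bounds

module Triples {m : ℕ} (bb : Blackbox m) where
  open import Data.Nat.Base using (_+_; _*_; _≤_; _<_)
  open State
  open Semantics bb

  -- The semantics counts steps exactly and branches differ in length; an upper bound lets both arms
  -- of a conditional satisfy one triple.
  record Reaches (p : Program) (σ : State m) (bound : ℕ) (Post : State m → Set) : Set where
    constructor reaches
    field
      {final}  : State m
      {time}   : ℕ
      run      : p ⊢ σ ⇓ final after time
      in-time  : time ≤ bound
      holds    : Post final

  module _ {Post : State m → Set} where

    last : ∀ {p σ σ′} → p ⊢ σ ⇓ σ′ after 1 → Post σ′ → Reaches p σ 1 Post
    last run holds = reaches run ℕ.≤-refl holds

    infixr 5 _next_

    _next_ : ∀ {p q σ σ′ b} → p ⊢ σ ⇓ σ′ after 1 → Reaches q σ′ b Post → Reaches (p ⨟ q) σ (suc b) Post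
    run next reaches run′ in-time holds = reaches (run ⨟ run′) (s≤s in-time) holds

    _then_ : ∀ {Mid : State m → Set} {p q σ b c} → Reaches p σ b Mid →
             (∀ {σ′} → Mid σ′ → Reaches q σ′ c Post) → Reaches (p ⨟ q) σ (b + c) Post
    reaches run in-time mid then continue with reaches run′ in-time′ holds ← continue mid =
      reaches (run ⨟ run′) (ℕ.+-mono-≤ in-time in-time′) holds

    within : ∀ {p σ b c} → b ≤ c → Reaches p σ b Post → Reaches p σ c Post
    within b≤c (reaches run in-time holds) = reaches run (ℕ.≤-trans in-time b≤c) holds

    holding : ∀ {Post′ : State m → Set} {p σ b} → (∀ {σ′} → Post σ′ → Post′ σ′) →
              Reaches p σ b Post → Reaches p σ b Post′
    holding f (reaches run in-time holds) = reaches run in-time (f holds)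

    taken : ∀ {x y p q σ b} → register σ x < register σ y →
            Reaches p σ b Post → Reaches (ifLess x y p q) σ (suc b) Post
    taken x<y (reaches run in-time holds) = reaches (if-true x<y run) (s≤s in-time) holds

    skipped : ∀ {x y p q σ b} → ¬ (register σ x < register σ y) →
              Reaches q σ b Post → Reaches (ifLess x y p q) σ (suc b) Post
    skipped x≮y (reaches run in-time holds) = reaches (if-false x≮y run) (s≤s in-time) holds

  -- `Inv k` is to hold when exactly `k` rounds are left. Each round pays one step for its test, and
  -- the final failing test is the `+ 1`.
  while : ∀ {x y p b} (Inv : ℕ → State m → Set) →
          (∀ {k σ} → Inv (suc k) σ → register σ x < register σ y × Reaches p σ b (Inv k)) →
          (∀ {σ} → Inv 0 σ → ¬ (register σ x < register σ y)) →
          ∀ k {σ} → Inv k σ → Reaches (whileLess x y p) σ (k * suc b + 1) (Inv 0)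
  while Inv body exit zero    inv = last (while-done (exit inv)) inv
  while {b = b} Inv body exit (suc k) inv
    with x<y , reaches run in-time inv′ ← body inv
    with reaches run′ in-time′ inv″ ← while Inv body exit k inv′ =
      reaches (while-step x<y run run′)
        (s≤s (ℕ.≤-trans (ℕ.+-mono-≤ in-time in-time′) (ℕ.≤-reflexive (≡.sym (ℕ.+-assoc b (k * suc b) 1)))))
        inv″

-- Correctness of the program

module _ where
  open import Data.Nat.Base using (_+_; _*_; _^_; _≤_)

  -- The bracketing follows the programs, so that the bounds computed by the triples match as they
  -- stand. The 10 is 9 steps of `consider` and one loop test; the other constants count the single
  -- instructions around the loops and, at the very end, the final conditional.
  advanceTime runTime totalTime : ℕ → ℕ
  advanceTime m = 3 + ((2 + (m * 10 + 1)) + 1)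
  runTime m     = 4 + ((m * suc (advanceTime m) + 1) + 2)
  totalTime m   = (m * suc (runTime m) + 1) + 2

  -- totalTime m = 10 m³ + 8 m² + 8 m + 3.
  totalTime-polynomial : ∀ m → totalTime m ≤ 26 * m ^ 3 + 26
  totalTime-polynomial zero    = ℕ.m≤m+n 3 23
  -- The 26 is 10 + 8 + 8: for `m ≥ 1` every power is at most the cube. As a polynomial in `m` the
  -- slack has negative coefficients; in `n = m - 1` all of them are natural.
  totalTime-polynomial (suc n) =
    ℕ.≤-trans (ℕ.m≤m+n _ (16 * n ^ 3 + 40 * n ^ 2 + 24 * n + 23)) (ℕ.≤-reflexive (identity n))
    where
    identity : ∀ n → totalTime (suc n) + (16 * n ^ 3 + 40 * n ^ 2 + 24 * n + 23) ≡ 26 * suc n ^ 3 + 26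
    identity = solve 1 (λ n → let m = con 1 :+ n in
      ((m :* (con 1 :+ (con 4 :+ ((m :* (con 1 :+ (con 3 :+ ((con 2 :+ (m :* con 10 :+ con 1)) :+ con 1)))
        :+ con 1) :+ con 2))) :+ con 1) :+ con 2)
        :+ (con 16 :* n :^ 3 :+ con 40 :* n :^ 2 :+ con 24 :* n :+ con 23)
      := con 26 :* m :^ 3 :+ con 26) refl
      where open +-*-Solver

-- Geometry enters through the blackbox alone: its answers on two single distances from a common
-- point must agree with a transitive relation.
module Correctness {m : ℕ} (bb : Blackbox m) (Nearer : Fin m → Rel (Fin m) 0ℓ)
  (bb-true  : ∀ {c i j} → bb ((c , i) ∷ []) ((c , j) ∷ []) ≡ true → Nearer c i j)
  (bb-false : ∀ {c i j} → bb ((c , i) ∷ []) ((c , j) ∷ []) ≡ false → Nearer c j i)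
  (nearer-trans : ∀ {c i j k} → Nearer c i j → Nearer c j k → Nearer c i k) where

  open import Data.Nat.Base using (_+_; _*_; _≤_; _<_)
  open State
  open Semantics bb
  open Triples bb
  open DecMembership (Fin._≟_ {m}) using (_∈?_)

  Path : List (Fin m) → Set
  Path = IsHamiltonPathThrough (allFin m)

  GreedyPath : Fin m → List (Fin m) → Set
  GreedyPath = Greedy (λ _ → ⊤) Nearer

  -- Either answer of the blackbox to the comparison of `i` with itself yields the claim.
  nearer-refl : ∀ {c i} → Nearer c i i
  nearer-refl {c} {i} with bb ((c , i) ∷ []) ((c , i) ∷ []) in eq
  ... | true  = bb-true eq
  ... | false = bb-false eq

  -- Steps that change other parts of the state leave the frame definitionally equal,
  -- so that Running carries over without proof.
  record Frame : Set where
    field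
      points′ origin′ mark′ visited′ nought′ : ℕ
      memory′                                : ℕ → ℕ
      path′                                  : List (Fin m)
      output′                                : List (List (Fin m))

  frame : State m → Frame
  frame σ = record
    { points′  = register σ points
    ; origin′  = register σ origin
    ; mark′    = register σ mark
    ; visited′ = register σ visited
    ; nought′  = register σ nought
    ; memory′  = memory σ
    ; path′    = path σ
    ; output′  = output σ
    }

  record Running (s k : ℕ) (vis : List (Fin m)) (out : List (List (Fin m))) (φ : Frame) : Set where
    open Frame φ
    field
      points≡  : points′ ≡ m
      origin≡  : origin′ ≡ s
      mark≡    : mark′ ≡ suc s
      visited≡ : visited′ ≡ k
      nought≡  : nought′ ≡ 0
      marked   : ∀ {i} → i ∈ vis → memory′ (toℕ i) ≡ suc s
      -- Runs from earlier origins left marks of at most `s`; comparing a cell with the mark `s + 1`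
      -- therefore detects exactly the visits of the present run.
      unmarked : ∀ {i} → i ∉ vis → memory′ (toℕ i) ≤ s
      path≡    : path′ ≡ reverse vis
      output≡  : output′ ≡ out

  -- Scanning for the nearest unvisited point

  data Choice (c : Fin m) (vis : List (Fin m)) (J b : ℕ) : Set where
    none : b ≡ m → (∀ {i} → toℕ i < J → i ∈ vis) → Choice c vis J b
    some : ∀ i → b ≡ toℕ i → i ∉ vis → (∀ {j} → toℕ j < J → j ∉ vis → Nearer c i j) → Choice c vis J b

  -- J is the current candidate, the points before J′ have been considered.
  record Scanning (s k : ℕ) (c : Fin m) (vis : List (Fin m)) (out : List (List (Fin m))) (J J′ : ℕ)
                  (σ : State m) : Set where
    field
      running    : Running s k vis out (frame σ)
      current≡   : register σ current ≡ toℕ c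
      candidate≡ : register σ candidate ≡ J
      left≡      : left σ ≡ []
      right≡     : right σ ≡ []
      choice     : Choice c vis J′ (register σ best)
    open Running running public

  module _ {s k : ℕ} {c : Fin m} {vis : List (Fin m)} {out : List (List (Fin m))} where

    private
      S : ℕ → ℕ → State m → Set
      S = Scanning s k c vis out

    extend : ∀ {j b} → j ∈ vis → Choice c vis (toℕ j) b → Choice c vis (suc (toℕ j)) b
    extend {j} j∈ (none b≡ all∈) = none b≡ all∈′
      where
      all∈′ : ∀ {i} → toℕ i < suc (toℕ j) → i ∈ vis
      all∈′ i<1+j with ℕ.m<1+n⇒m<n∨m≡n i<1+j
      ... | inj₁ i<j = all∈ i<j
      ... | inj₂ i≡j with refl ← Fin.toℕ-injective i≡j = j∈
    extend {j} j∈ (some i b≡ i∉ nearest) = some i b≡ i∉ nearest′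
      where
      nearest′ : ∀ {z} → toℕ z < suc (toℕ j) → z ∉ vis → Nearer c i z
      nearest′ z<1+j z∉ with ℕ.m<1+n⇒m<n∨m≡n z<1+j
      ... | inj₁ z<j = nearest z<j z∉
      ... | inj₂ z≡j with refl ← Fin.toℕ-injective z≡j = contradiction j∈ z∉

    choose : ∀ {i j} → (∀ {z} → toℕ z < toℕ j → z ∉ vis → Nearer c i z) → Nearer c i j →
             ∀ {z} → toℕ z < suc (toℕ j) → z ∉ vis → Nearer c i z
    choose nearest near z<1+j z∉ with ℕ.m<1+n⇒m<n∨m≡n z<1+j
    ... | inj₁ z<j = nearest z<j z∉
    ... | inj₂ z≡j with refl ← Fin.toℕ-injective z≡j = near

    consider-correct : ∀ (j : Fin m) {σ} → S (toℕ j) (toℕ j) σ →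
                       Reaches consider σ 9 (S (suc (toℕ j)) (suc (toℕ j)))
    consider-correct j {σ} scanning = load next (decide then λ decided →
      last inc (record { Scanning decided ; candidate≡ = cong suc (Scanning.candidate≡ decided) }))
      where
      open Scanning scanning
      σ₁ : State m
      σ₁ = record σ { register = register σ [ answer ↦ memory σ (register σ candidate) ] }

      Considered : State m → Set
      Considered = S (toℕ j) (suc (toℕ j))

      better : ∀ {i} → register σ best ≡ toℕ i → i ∉ vis →
               (∀ {z} → toℕ z < toℕ j → z ∉ vis → Nearer c i z) → j ∉ vis →
               Reaches replaceIfNearer σ₁ 5 Considered
      better {i} b≡ i∉ nearest j∉ = addLeft {j = j} current≡ candidate≡ next addRight {j = i} current≡ b≡ next
        compare next test
        where
        left₁ right₁ : PairList m
        left₁  = (c , j) ∷ left σ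
        right₁ = (c , i) ∷ right σ

        test : Reaches (ifLess nought answer (copy best candidate) skip)
          (record σ₁ { register = register σ₁ [ answer ↦ (if bb left₁ right₁ then 1 else 0) ]
                     ; left = [] ; right = [] })
          2 Considered
        -- Both sums were empty before, so each side of the comparison is a single distance, the
        -- form that `bb-true` and `bb-false` cover.
        test rewrite left≡ | right≡ with bb ((c , j) ∷ []) ((c , i) ∷ []) in eq
        ... | true  = taken (ℕ.≤-reflexive (cong suc nought≡)) (last copy (record
          { running = running ; current≡ = current≡ ; candidate≡ = candidate≡ ; left≡ = refl ; right≡ = refl
          ; choice = some j candidate≡ j∉
              (choose (λ z< z∉ → nearer-trans (bb-true eq) (nearest z< z∉)) nearer-refl) }))
        ... | false = skipped (λ ()) (last skip (record
          { running = running ; current≡ = current≡ ; candidate≡ = candidate≡ ; left≡ = refl ; right≡ = refl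
          ; choice = some i b≡ i∉ (choose nearest (bb-false eq)) }))

      replace : Choice c vis (toℕ j) (register σ best) → j ∉ vis →
                Reaches (ifLess best points replaceIfNearer (copy best candidate)) σ₁ 6 Considered
      replace (some i b≡ i∉ nearest) j∉ =
        taken (ℕ.≤-trans (ℕ.≤-reflexive (cong suc b≡))
                (ℕ.≤-trans (Fin.toℕ<n i) (ℕ.≤-reflexive (≡.sym points≡))))
              (better b≡ i∉ nearest j∉)
      replace (none b≡ all∈) j∉ = within (s≤s (s≤s z≤n))
        (skipped (ℕ.<-irrefl (≡.trans b≡ (≡.sym points≡))) (last copy (record
          { running = running ; current≡ = current≡ ; candidate≡ = candidate≡ ; left≡ = left≡ ; right≡ = right≡
          ; choice = some j candidate≡ j∉
              (choose (λ z< z∉ → contradiction (all∈ z<) z∉) nearer-refl) })))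

      decide : Reaches examine σ₁ 7 Considered
      decide with j ∈? vis
      ... | yes j∈ = within (s≤s (s≤s z≤n)) (skipped
        (ℕ.<-irrefl (≡.trans (≡.trans (cong (memory σ) candidate≡) (marked j∈)) (≡.sym mark≡)))
        (last skip (record { running = running ; current≡ = current≡ ; candidate≡ = candidate≡
                           ; left≡ = left≡ ; right≡ = right≡ ; choice = extend j∈ choice })))
      ... | no  j∉ = taken
        (ℕ.≤-trans (s≤s (ℕ.≤-trans (ℕ.≤-reflexive (cong (memory σ) candidate≡)) (unmarked j∉)))
          (ℕ.≤-reflexive (≡.sym mark≡)))
        (replace choice j∉)

    scan-correct : ∀ {σ} → Running s k vis out (frame σ) → register σ current ≡ toℕ c →
                   left σ ≡ [] → right σ ≡ [] → Reaches scan σ (2 + (m * 10 + 1)) (S m m)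
    scan-correct {σ} running current≡ left≡ right≡ = copy next set next holding finished
      (while ScannedUpTo body exit m (0 , refl , record
        { running = running ; current≡ = current≡ ; candidate≡ = refl ; left≡ = left≡ ; right≡ = right≡
        ; choice = none (Running.points≡ running) λ () }))
      where
      ScannedUpTo : ℕ → State m → Set
      ScannedUpTo rest σ = ∃ λ J → J + rest ≡ m × S J J σ

      body : ∀ {rest σ} → ScannedUpTo (suc rest) σ →
             register σ candidate < register σ points × Reaches consider σ 9 (ScannedUpTo rest)
      body {rest} (J , J+rest≡m , scanning) =
        ℕ.≤-trans (s≤s (ℕ.≤-reflexive candidate≡)) (ℕ.≤-trans J<m (ℕ.≤-reflexive (≡.sym points≡))) ,
        holding (λ scanned → suc J , ≡.trans (≡.sym (ℕ.+-suc J rest)) J+rest≡m , scanned)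
          (subst (λ J → S J J _ → Reaches consider _ 9 (S (suc J) (suc J)))
            (Fin.toℕ-fromℕ< J<m) (consider-correct (fromℕ< J<m)) scanning)
        where
        open Scanning scanning
        J<m : J < m
        J<m = m+1+n≡o⇒m<o J+rest≡m

      exit : ∀ {σ} → ScannedUpTo 0 σ → ¬ (register σ candidate < register σ points)
      exit (J , J+0≡m , scanning) = ℕ.<-irrefl
        (≡.trans candidate≡ (≡.trans (≡.sym (ℕ.+-identityʳ J)) (≡.trans J+0≡m (≡.sym points≡))))
        where open Scanning scanning

      finished : ∀ {σ} → ScannedUpTo 0 σ → S m m σ
      finished {σ} (J , J+0≡m , scanning) =
        subst (λ J → S J J σ) (≡.trans (≡.sym (ℕ.+-identityʳ J)) J+0≡m) scanning

  -- Growing one path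

  -- rest is the number of unvisited points.
  Pending : Fin m → List (Fin m) → ℕ → ℕ → Set
  Pending x vis zero       b = GreedyPath x vis
  Pending x vis (suc rest) b = ∃ λ i → b ≡ toℕ i × GreedyPath x (i ∷ vis)

  record Growing (x : Fin m) (out : List (List (Fin m))) (rest : ℕ) (σ : State m) : Set where
    field
      vis     : List (Fin m)
      length≡ : length vis + rest ≡ m
      running : Running (toℕ x) (length vis) vis out (frame σ)
      left≡   : left σ ≡ []
      right≡  : right σ ≡ []
      pending : Pending x vis rest (register σ best)
    open Running running public

  -- After the last visit the scan still runs, and its result is discarded. While points remain it
  -- cannot come back empty: the visited list would contain all `m` points and yet be shorter than
  -- `m`.
  choice⇒pending : ∀ {x c vis b} rest → GreedyPath x (c ∷ vis) → length (c ∷ vis) + rest ≡ m →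
                   Choice c (c ∷ vis) m b → Pending x (c ∷ vis) rest b
  choice⇒pending zero       greedy _ _ = greedy
  choice⇒pending {c = c} {vis} (suc rest) greedy length≡ (none _ all∈) = contradiction
    (ℕ.<-≤-trans (m+1+n≡o⇒m<o length≡)
      (covering⇒length-≥ {xs = c ∷ vis} (λ i → all∈ (Fin.toℕ<n i))))
    (ℕ.<-irrefl refl)
  choice⇒pending (suc rest) greedy _ (some i b≡ i∉ nearest) =
    i , b≡ , step greedy tt i∉ λ {z} _ → nearest (Fin.toℕ<n z)

  advance-correct : ∀ {x out rest σ} → Growing x out (suc rest) σ →
    register σ visited < register σ points × Reaches advance σ (advanceTime m) (Growing x out rest)
  advance-correct {x} {out} {rest} {σ} growing with Growing.pending growing
  ... | c , best≡ , greedy =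
    ℕ.≤-trans (s≤s (ℕ.≤-reflexive visited≡)) (ℕ.≤-trans length<m (ℕ.≤-reflexive (≡.sym points≡))) ,
    (copy next visit {i = c} best≡ next store next (scan-correct running′ best≡ left≡ right≡ then finished))
    where
    open Growing growing
    length<m : length vis < m
    length<m = m+1+n≡o⇒m<o length≡

    memory₁ : ℕ → ℕ
    memory₁ = memory σ [ register σ best ↦ register σ mark ]

    marked₁ : ∀ {i} → i ∈ c ∷ vis → memory₁ (toℕ i) ≡ suc (toℕ x)
    marked₁ {i} i∈ with i Fin.≟ c | i∈
    ... | yes refl | _         = ≡.trans (update-≡ (memory σ) (≡.sym best≡)) mark≡
    ... | no i≢c   | here i≡c  = contradiction i≡c i≢c
    ... | no i≢c   | there i∈′ =
      ≡.trans (update-≢ (memory σ) (λ eq → i≢c (Fin.toℕ-injective (≡.trans eq best≡)))) (marked i∈′)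

    unmarked₁ : ∀ {i} → i ∉ c ∷ vis → memory₁ (toℕ i) ≤ toℕ x
    unmarked₁ {i} i∉ = ℕ.≤-trans
      (ℕ.≤-reflexive (update-≢ (memory σ) (λ eq → i∉ (here (Fin.toℕ-injective (≡.trans eq best≡))))))
      (unmarked (i∉ ∘ there))

    running′ : Running (toℕ x) (length vis) (c ∷ vis) out (record (frame σ)
      { memory′ = memory₁ ; path′ = path σ ∷ʳ c })
    running′ = record
      { points≡ = points≡ ; origin≡ = origin≡ ; mark≡ = mark≡ ; visited≡ = visited≡ ; nought≡ = nought≡
      ; marked = marked₁ ; unmarked = unmarked₁
      ; path≡ = ≡.trans (cong (_∷ʳ c) path≡) (≡.sym (unfold-reverse c vis))
      ; output≡ = output≡ }

    finished : ∀ {σ} → Scanning (toℕ x) (length vis) c (c ∷ vis) out m m σ →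
               Reaches (inc visited) σ 1 (Growing x out rest)
    finished scanned = last inc (record
      { vis = c ∷ vis ; length≡ = length≡′ ; left≡ = T.left≡ ; right≡ = T.right≡
      ; running = record { Running T.running ; visited≡ = cong suc T.visited≡ }
      ; pending = choice⇒pending rest greedy length≡′ T.choice })
      where
      module T = Scanning scanned
      length≡′ : length (c ∷ vis) + rest ≡ m
      length≡′ = ≡.trans (≡.sym (ℕ.+-suc _ rest)) length≡

  -- The runs from all starting points

  record Collected (s : ℕ) (out : List (List (Fin m))) : Set where
    field
      paths  : All Path out
      greedy : ∀ {x} → toℕ x < s → ∃ λ vis → GreedyPath x vis × length vis ≡ m × reverse vis ∈ out

  record Searching (rest : ℕ) (σ : State m) : Set where
    field
      {s}       : ℕ
      s+rest≡m  : s + rest ≡ m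
      points≡   : register σ points ≡ m
      origin≡   : register σ origin ≡ s
      nought≡   : register σ nought ≡ 0
      memory≤   : ∀ (i : Fin m) → memory σ (toℕ i) ≤ s
      left≡     : left σ ≡ []
      right≡    : right σ ≡ []
      path≡     : path σ ≡ []
      collected : Collected s (output σ)

  collect : ∀ {x vis out} → GreedyPath x vis → length vis ≡ m → Collected (toℕ x) out →
            Collected (suc (toℕ x)) (out ∷ʳ reverse vis)
  collect {x} {vis} {out} g length≡ collected = record
    { paths  = All.++⁺ paths (↭-trans (↭-reverse vis) (unique∧length⇒↭allFin (greedy⇒unique g) length≡) ∷ [])
    ; greedy = greedy′
    }
    where
    open Collected collected
    greedy′ : ∀ {z} → toℕ z < suc (toℕ x) →
              ∃ λ vis′ → GreedyPath z vis′ × length vis′ ≡ m × reverse vis′ ∈ out ∷ʳ reverse vis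
    greedy′ z<1+x with ℕ.m<1+n⇒m<n∨m≡n z<1+x
    ... | inj₁ z<x with vis′ , g′ , length≡′ , ∈out ← greedy z<x = vis′ , g′ , length≡′ , ++⁺ˡ ∈out
    ... | inj₂ z≡x with refl ← Fin.toℕ-injective z≡x = vis , g , length≡ , ++⁺ʳ out (here refl)

  run-correct : ∀ {rest σ} → Searching (suc rest) σ →
    register σ origin < register σ points × Reaches runFrom σ (runTime m) (Searching rest)
  run-correct {rest} {σ} searching =
    ℕ.≤-trans (s≤s (ℕ.≤-reflexive origin≡)) (ℕ.≤-trans s<m (ℕ.≤-reflexive (≡.sym points≡))) ,
    (copy next inc next copy next set next
      (while (Growing x (output σ)) advance-correct exit m initially then finished))
    where
    open Searching searching
    s<m : s < m
    s<m = m+1+n≡o⇒m<o s+rest≡m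

    x : Fin m
    x = fromℕ< s<m

    x≡s : toℕ x ≡ s
    x≡s = Fin.toℕ-fromℕ< s<m

    origin≡x : register σ origin ≡ toℕ x
    origin≡x = ≡.trans origin≡ (≡.sym x≡s)

    -- `Pending` computes by cases on the number of points left; the variable `k` stands in for the
    -- fixed `m` so that the cases can be split.
    pending₀ : ∀ {k b} → k ≡ m → b ≡ toℕ x → Pending x [] k b
    pending₀ {zero}  0≡m  b≡ = contradiction (subst (s <_) (≡.sym 0≡m) s<m) λ ()
    pending₀ {suc k} _    b≡ = x , b≡ , start tt

    σ₁ : State m
    σ₁ = record σ { register = register σ [ mark ↦ register σ origin ] [ mark ↦ suc (register σ origin) ]
                                          [ best ↦ register σ origin ] [ visited ↦ 0 ] }

    initially : Growing x (output σ) m σ₁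
    initially = record
      { vis = [] ; length≡ = refl ; left≡ = left≡ ; right≡ = right≡ ; pending = pending₀ refl origin≡x
      ; running = record
        { points≡ = points≡ ; origin≡ = origin≡x ; mark≡ = cong suc origin≡x ; visited≡ = refl
        ; nought≡ = nought≡ ; marked = λ () ; unmarked = λ {i} _ → subst (memory σ (toℕ i) ≤_) (≡.sym x≡s) (memory≤ i)
        ; path≡ = path≡ ; output≡ = refl } }

    exit : ∀ {σ′} → Growing x (output σ) 0 σ′ → ¬ (register σ′ visited < register σ′ points)
    exit growing = ℕ.<-irrefl
      (≡.trans G.visited≡ (≡.trans (≡.sym (ℕ.+-identityʳ _)) (≡.trans G.length≡ (≡.sym G.points≡))))
      where module G = Growing growing

    finished : ∀ {σ′} → Growing x (output σ) 0 σ′ → Reaches (finish ⨟ inc origin) σ′ 2 (Searching rest)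
    finished {σ′} growing = finish next last inc (record
      { s = suc s
      ; s+rest≡m = ≡.trans (≡.sym (ℕ.+-suc s rest)) s+rest≡m
      ; points≡ = G.points≡ ; origin≡ = cong suc (≡.trans G.origin≡ x≡s) ; nought≡ = G.nought≡
      ; memory≤ = memory≤′ ; left≡ = G.left≡ ; right≡ = G.right≡ ; path≡ = refl
      ; collected = collected′ })
      where
      module G = Growing growing

      memory≤′ : ∀ i → memory σ′ (toℕ i) ≤ suc s
      memory≤′ i with i ∈? G.vis
      ... | yes i∈ = ℕ.≤-reflexive (≡.trans (G.marked i∈) (cong suc x≡s))
      ... | no  i∉ = ℕ.m≤n⇒m≤1+n (ℕ.≤-trans (G.unmarked i∉) (ℕ.≤-reflexive x≡s))

      collected′ : Collected (suc s) (output σ′ ∷ʳ path σ′)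
      collected′ rewrite G.output≡ | G.path≡ =
        subst (λ s → Collected (suc s) (output σ ∷ʳ reverse G.vis)) x≡s
          (collect G.pending (≡.trans (≡.sym (ℕ.+-identityʳ _)) G.length≡)
            (subst (λ s → Collected s (output σ)) (≡.sym x≡s) collected))

  record Solved (out : List (List (Fin m))) : Set where
    field
      paths  : All Path out
      greedy : ∀ x → ∃ λ vis → GreedyPath x vis × length vis ≡ m × reverse vis ∈ out
      -- For `m ≡ 0` there is no starting point and `greedy` is vacuous, so the empty path is
      -- recorded separately.
      empty  : m ≡ 0 → [] ∈ out

  program-correct : Reaches nearestNeighborProgram (initial m) (totalTime m) (Solved ∘ output)
  program-correct = while Searching run-correct exit m initially then finished
    where
    initially : Searching m (initial m)
    initially = record
      { s+rest≡m = refl ; points≡ = refl ; origin≡ = refl ; nought≡ = refl ; memory≤ = λ _ → z≤n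
      ; left≡ = refl ; right≡ = refl ; path≡ = refl ; collected = record { paths = [] ; greedy = λ () } }

    exit : ∀ {σ} → Searching 0 σ → ¬ (register σ origin < register σ points)
    exit searching = ℕ.<-irrefl
      (≡.trans origin≡ (≡.trans (≡.sym (ℕ.+-identityʳ _)) (≡.trans s+rest≡m (≡.sym points≡))))
      where open Searching searching

    finished : ∀ {σ} → Searching 0 σ → Reaches (ifLess nought points skip finish) σ 2 (Solved ∘ output)
    finished {σ} searching with 0 ℕ.<? m
    ... | yes 0<m = within (s≤s (s≤s z≤n)) (taken
      (ℕ.≤-trans (s≤s (ℕ.≤-reflexive nought≡)) (ℕ.≤-trans 0<m (ℕ.≤-reflexive (≡.sym points≡))))
      (last skip (record { paths = paths ; greedy = λ x → greedy (x<s x) ; empty = λ m≡0 → contradiction (≡.sym m≡0) (ℕ.<⇒≢ 0<m) })))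
      where
      open Searching searching
      open Collected collected
      x<s : ∀ x → toℕ x < s
      x<s x = ℕ.≤-trans (Fin.toℕ<n x) (ℕ.≤-reflexive (≡.trans (≡.sym s+rest≡m) (ℕ.+-identityʳ s)))
    ... | no  0≮m = skipped
      (λ lt → 0≮m (ℕ.≤-trans (s≤s z≤n) (ℕ.≤-trans lt (ℕ.≤-reflexive points≡))))
      (last finish (record
        { paths = All.++⁺ paths (subst Path (≡.sym path≡) (unique∧length⇒↭allFin [] (≡.sym m≡0)) ∷ [])
        ; greedy = λ x → contradiction (Fin.toℕ<n x) (λ x<m → 0≮m (ℕ.≤-trans (s≤s z≤n) x<m))
        ; empty = λ _ → ++⁺ʳ (output σ) (here (≡.sym path≡)) }))
      where
      open Searching searching
      open Collected collected
      m≡0 : m ≡ 0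
      m≡0 = ℕ.n≤0⇒n≡0 (ℕ.≮⇒≥ 0≮m)

-- Euclidean distances and general position

module Geometry (ℝ : RealNumbers) where
  open RealNumbers ℝ renaming (refl to ≈-refl)
  open SquareRoot ℝ
  open Euclidean ℝ
  open RingProperties ring using (-1*x≈-x; -‿involutive; -‿distribˡ-*; -‿distribʳ-*)
  open AbelianGroupProperties +-abelianGroup using (⁻¹-anti-homo‿-)
  open Sum +-commutativeMonoid using (sum; sum-cong-≋; sum-replicate-zero; ∑-distrib-+)
  open NatSolver commutativeSemiring using (solve; _:=_; _:+_; _:*_)

  +-mono-≤ : ∀ {a b c d} → a ≤ b → c ≤ d → a + c ≤ b + d
  +-mono-≤ {a} {b} {c} {d} a≤b c≤d = begin
    a + c  ≤⟨ +-monoʳ-≤ a c≤d ⟩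
    a + d  ≈⟨ +-comm a d ⟩
    d + a  ≤⟨ +-monoʳ-≤ d a≤b ⟩
    d + b  ≈⟨ +-comm d b ⟩
    b + d  ∎
    where open ≤R

  square-mono-≤ : ∀ {a b} → 0# ≤ a → a ≤ b → a * a ≤ b * b
  square-mono-≤ {a} {b} 0≤a a≤b = begin
    a * a  ≤⟨ *-monoˡ-≤ 0≤a a≤b ⟩
    a * b  ≈⟨ *-comm a b ⟩
    b * a  ≤⟨ *-monoˡ-≤ (≤-trans 0≤a a≤b) a≤b ⟩
    b * b  ∎
    where open ≤R

  -- Sums

  sum-mono-≤ : ∀ {n} (f g : Fin n → Carrier) → (∀ i → f i ≤ g i) → sum f ≤ sum g
  sum-mono-≤ {zero}  f g f≤g = ≤-refl
  sum-mono-≤ {suc n} f g f≤g = +-mono-≤ (f≤g Fin.zero) (sum-mono-≤ (f ∘ Fin.suc) (g ∘ Fin.suc) (f≤g ∘ Fin.suc))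

  sum-zero : ∀ {n} (f : Fin n → Carrier) → (∀ i → f i ≈ 0#) → sum f ≈ 0#
  sum-zero {n} f f≈0 = trans (sum-cong-≋ f≈0) (sum-replicate-zero n)

  sum-single : ∀ {n} (f : Fin n → Carrier) a → (∀ i → i ≢ a → f i ≈ 0#) → sum f ≈ f a
  sum-single f Fin.zero    f≈0 = trans (+-congˡ (sum-zero (f ∘ Fin.suc) λ i → f≈0 (Fin.suc i) λ ())) (+-identityʳ _)
  sum-single f (Fin.suc a) f≈0 = trans
    (+-cong (f≈0 Fin.zero λ ()) (sum-single (f ∘ Fin.suc) a λ i i≢a → f≈0 (Fin.suc i) (i≢a ∘ Fin.suc-injective)))
    (+-identityˡ _)

  -- Distances

  dist-nonNegative : ∀ {d} (p q : Point d) → 0# ≤ dist p q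
  dist-nonNegative p q = proj₁ (proj₂ (sqrt (squaredDist p q) _))

  dist-square : ∀ {d} (p q : Point d) → dist p q * dist p q ≈ squaredDist p q
  dist-square p q = proj₂ (proj₂ (sqrt (squaredDist p q) _))

  squaredDist-mono⁻ : ∀ {d} (p q r s : Point d) → dist p q ≤ dist r s → squaredDist p q ≤ squaredDist r s
  squaredDist-mono⁻ p q r s le = begin
    squaredDist p q      ≈⟨ dist-square p q ⟨
    dist p q * dist p q  ≤⟨ square-mono-≤ (dist-nonNegative p q) le ⟩
    dist r s * dist r s  ≈⟨ dist-square r s ⟩
    squaredDist r s      ∎
    where open ≤R

  dist≤⇒squaredDist≤ : ∀ {d} (p q : Point d) {a} → dist p q ≤ a → squaredDist p q ≤ a * a
  dist≤⇒squaredDist≤ p q le =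
    ≤-trans (≤-reflexive (sym (dist-square p q))) (square-mono-≤ (dist-nonNegative p q) le)

  squaredDist≤⇒dist≤ : ∀ {d} (p q : Point d) {a} → 0# ≤ a → squaredDist p q ≤ a * a → dist p q ≤ a
  squaredDist≤⇒dist≤ p q 0≤a le = square-cancel-≤ 0≤a (≤-trans (≤-reflexive (dist-square p q)) le)

  dist-cong : ∀ {d} (p q r s : Point d) → squaredDist p q ≈ squaredDist r s → dist p q ≈ dist r s
  dist-cong p q r s eq = antisym
    (squaredDist≤⇒dist≤ p q (dist-nonNegative r s) (≤-reflexive (trans eq (sym (dist-square r s)))))
    (squaredDist≤⇒dist≤ r s (dist-nonNegative p q) (≤-reflexive (trans (sym eq) (sym (dist-square p q)))))

  dist-resp-≋ : ∀ {d} (p q p′ q′ : Point d) → p ≋ p′ → q ≋ q′ → dist p q ≈ dist p′ q′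
  dist-resp-≋ p q p′ q′ p≋ q≋ = dist-cong p q p′ q′
    (sum-cong-≋ λ k → *-cong (+-cong (p≋ k) (-‿cong (q≋ k))) (+-cong (p≋ k) (-‿cong (q≋ k))))

  difference-sum : ∀ a b c → a - c ≈ (a - b) + (b - c)
  difference-sum a b c = sym (begin
    (a - b) + (b - c)    ≈⟨ +-assoc a (- b) (b - c) ⟩
    a + (- b + (b - c))  ≈⟨ +-congˡ (+-assoc (- b) b (- c)) ⟨
    a + ((- b + b) - c)  ≈⟨ +-congˡ (+-congʳ (-‿inverseˡ b)) ⟩
    a + (0# - c)         ≈⟨ +-congˡ (+-identityˡ (- c)) ⟩
    a - c                ∎)
    where open ≈R

  -- This is the identity `(x + y)² + (x - y)² = 2x² + 2y²` with a square dropped. The solver knows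
  -- no subtraction, so `x` is written as `y + w`.
  square-sum-≤ : ∀ x y → (x + y) * (x + y) ≤ (x * x + x * x) + (y * y + y * y)
  square-sum-≤ x y = begin
    (x + y) * (x + y)                              ≈⟨ *-cong x+y≈ x+y≈ ⟩
    ((y + w) + y) * ((y + w) + y)                  ≤⟨ x≤x+y _ (square-nonNegative w) ⟩
    ((y + w) + y) * ((y + w) + y) + w * w          ≈⟨ identity y w ⟩
    ((y + w) * (y + w) + (y + w) * (y + w)) + (y * y + y * y)
                                                   ≈⟨ +-congʳ (+-cong x²≈ x²≈) ⟨
    (x * x + x * x) + (y * y + y * y)              ∎
    where
    open ≤R
    w : Carrier
    w = x - y
    x≈y+w : x ≈ y + w
    x≈y+w = split y x
    x+y≈ : x + y ≈ (y + w) + y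
    x+y≈ = +-congʳ x≈y+w
    x²≈ : x * x ≈ (y + w) * (y + w)
    x²≈ = *-cong x≈y+w x≈y+w
    identity : ∀ y w → ((y + w) + y) * ((y + w) + y) + w * w
                       ≈ ((y + w) * (y + w) + (y + w) * (y + w)) + (y * y + y * y)
    identity = solve 2 (λ y w → ((y :+ w) :+ y) :* ((y :+ w) :+ y) :+ w :* w
      := ((y :+ w) :* (y :+ w) :+ (y :+ w) :* (y :+ w)) :+ (y :* y :+ y :* y)) ≈-refl

  -- The inequality for squares holds in each coordinate and is summed. It replaces the triangle
  -- inequality for `dist`, which would call for Cauchy-Schwarz.
  squaredDist-triangle : ∀ {d} (p q r : Point d) →
    squaredDist p r ≤ (squaredDist p q + squaredDist p q) + (squaredDist q r + squaredDist q r)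
  squaredDist-triangle p q r = begin
    squaredDist p r
      ≤⟨ sum-mono-≤ _ _ (λ k → ≤-trans
           (≤-reflexive (*-cong (difference-sum (p k) (q k) (r k)) (difference-sum (p k) (q k) (r k))))
           (square-sum-≤ (p k - q k) (q k - r k))) ⟩
    sum (λ k → (f k + f k) + (g k + g k))
      ≈⟨ ∑-distrib-+ (λ k → f k + f k) (λ k → g k + g k) ⟩
    sum (λ k → f k + f k) + sum (λ k → g k + g k)
      ≈⟨ +-cong (∑-distrib-+ f f) (∑-distrib-+ g g) ⟩
    (squaredDist p q + squaredDist p q) + (squaredDist q r + squaredDist q r) ∎
    where
    open ≤R
    f g : Fin _ → Carrier
    f k = (p k - q k) * (p k - q k)
    g k = (q k - r k) * (q k - r k)

  squaredDist-sym : ∀ {d} (p q : Point d) → squaredDist p q ≈ squaredDist q p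
  squaredDist-sym p q = sum-cong-≋ λ k → square-difference (p k) (q k)
    where
    square-difference : ∀ a b → (a - b) * (a - b) ≈ (b - a) * (b - a)
    square-difference a b = begin
      (a - b) * (a - b)      ≈⟨ -‿involutive _ ⟨
      - - ((a - b) * (a - b)) ≈⟨ -‿cong (-‿distribʳ-* (a - b) (a - b)) ⟩
      - ((a - b) * - (a - b)) ≈⟨ -‿distribˡ-* (a - b) (- (a - b)) ⟩
      - (a - b) * - (a - b)  ≈⟨ *-cong (⁻¹-anti-homo‿- a b) (⁻¹-anti-homo‿- a b) ⟩
      (b - a) * (b - a)      ∎
      where open ≈R

  dist-sym : ∀ {d} (p q : Point d) → dist p q ≈ dist q p
  dist-sym p q = dist-cong p q q p (squaredDist-sym p q)

  radius : Carrier
  radius = (1# + 1#) + (1# + 1#)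

  -- For squared distances the triangle inequality loses a factor 2: points of
  -- the unit ball have squared distance at most 2 + 2 = 4, and a point within
  -- that of one of them has squared distance at most 2 + 8 ≤ radius² from p.
  outside-unit-ball⇒farther : ∀ {d} (p s s′ z : Point d) → Ball p 1# s → Ball p 1# s′ → ¬ Ball p radius z →
                              ¬ (dist s z ≤ dist s s′)
  outside-unit-ball⇒farther p s s′ z ps≤1 ps′≤1 pz≰R sz≤ss′ =
    pz≰R (squaredDist≤⇒dist≤ p z 0≤radius (begin
      squaredDist p z
        ≤⟨ squaredDist-triangle p s z ⟩
      (squaredDist p s + squaredDist p s) + (squaredDist s z + squaredDist s z)
        ≤⟨ +-mono-≤ (+-mono-≤ ps ps) (+-mono-≤ sz sz) ⟩
      (u + u) + (((u + u) + (u + u)) + ((u + u) + (u + u)))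
        -- The estimate so far is `10 u`; the added `6 u` fill it up to the square of `radius`,
        -- which is `16 u`.
        ≤⟨ x≤x+y _ (+-nonNegative 0≤2u (+-nonNegative 0≤2u 0≤2u)) ⟩
      (u + u) + (((u + u) + (u + u)) + ((u + u) + (u + u))) + ((u + u) + ((u + u) + (u + u)))
        ≈⟨ identity 1# ⟩
      radius * radius ∎))
    where
    open ≤R
    u : Carrier
    u = 1# * 1#
    0≤2u : 0# ≤ u + u
    0≤2u = +-nonNegative (square-nonNegative 1#) (square-nonNegative 1#)
    0≤radius : 0# ≤ radius
    0≤radius = +-nonNegative (+-nonNegative 0≤1 0≤1) (+-nonNegative 0≤1 0≤1)
    ps : squaredDist p s ≤ u
    ps = dist≤⇒squaredDist≤ p s ps≤1
    sp : squaredDist s p ≤ u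
    sp = ≤-trans (≤-reflexive (squaredDist-sym s p)) ps
    ps′ : squaredDist p s′ ≤ u
    ps′ = dist≤⇒squaredDist≤ p s′ ps′≤1
    sz : squaredDist s z ≤ (u + u) + (u + u)
    sz = begin
      squaredDist s z   ≤⟨ squaredDist-mono⁻ s z s s′ sz≤ss′ ⟩
      squaredDist s s′  ≤⟨ squaredDist-triangle s p s′ ⟩
      (squaredDist s p + squaredDist s p) + (squaredDist p s′ + squaredDist p s′)
                        ≤⟨ +-mono-≤ (+-mono-≤ sp sp) (+-mono-≤ ps′ ps′) ⟩
      (u + u) + (u + u) ∎
    identity : ∀ e → (e * e + e * e) + (((e * e + e * e) + (e * e + e * e)) + ((e * e + e * e) + (e * e + e * e)))
                     + ((e * e + e * e) + ((e * e + e * e) + (e * e + e * e)))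
                     ≈ ((e + e) + (e + e)) * ((e + e) + (e + e))
    identity = solve 1 (λ e → let v = e :* e :+ e :* e in
      v :+ ((v :+ v) :+ (v :+ v)) :+ (v :+ (v :+ v)) := ((e :+ e) :+ (e :+ e)) :* ((e :+ e) :+ (e :+ e))) ≈-refl

  -- General position

  module _ {d m : ℕ} (y : Fin m → Point d) (general : GeneralPosition y) where

    private
      D : Fin m → Fin m → Carrier
      D i j = dist (y i) (y j)

      _≟²_ : (v w : Fin m × Fin m) → Dec (v ≡ w)
      _≟²_ = ≡-dec Fin._≟_ Fin._≟_

      at : Fin m × Fin m → Carrier → Fin m × Fin m → Carrier
      at v x w = if does (w ≟² v) then x else 0#

      at-≡ : ∀ v x → at v x v ≡ x
      at-≡ v x rewrite dec-true (v ≟² v) refl = refl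

      at-≢ : ∀ {v x w} → w ≢ v → at v x w ≡ 0#
      at-≢ {v} {x} {w} w≢v rewrite dec-false (w ≟² v) w≢v = refl

      sum-at : ∀ v x → sum (λ i → sum λ j → at v x (i , j)) ≈ x
      sum-at v@(a , b) x = begin
        sum (λ i → sum λ j → at v x (i , j))
          ≈⟨ sum-single _ a (λ i i≢a → sum-zero _ λ j → reflexive (at-≢ {v} {x} {i , j} (i≢a ∘ ≡.cong proj₁))) ⟩
        sum (λ j → at v x (a , j))
          ≈⟨ sum-single _ b (λ j j≢b → reflexive (at-≢ {v} {x} {a , j} (j≢b ∘ ≡.cong proj₂))) ⟩
        at v x v
          ≈⟨ reflexive (at-≡ v x) ⟩
        x ∎
        where open ≈R

    -- A tie would annihilate the signed sum with `+ˢ` at one pair, `-ˢ` at the other and `0ˢ`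
    -- elsewhere. Both pairs are increasing because the sum counts each distance once, at its
    -- increasing pair.
    ordered-distances-differ : ∀ {a b a′ b′} → a Fin.< b → a′ Fin.< b′ → (a , b) ≢ (a′ , b′) → ¬ (D a b ≈ D a′ b′)
    ordered-distances-differ {a} {b} {a′} {b′} a<b a′<b′ v≢v′ eq =
      general ξ (a , b , a<b , nonzero) vanishes
      where
      v v′ : Fin m × Fin m
      v  = a , b
      v′ = a′ , b′

      ξ : Fin m → Fin m → Sign₀
      ξ i j = if does ((i , j) ≟² v) then +ˢ else if does ((i , j) ≟² v′) then -ˢ else 0ˢ

      nonzero : ¬ (ξ a b ≡ 0ˢ)
      nonzero rewrite dec-true ((a , b) ≟² v) refl = λ ()

      term : ∀ i j → (if ⌊ i Fin.<? j ⌋ then ⟦ ξ i j ⟧ * D i j else 0#)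
                     ≈ at v (D a b) (i , j) + at v′ (- D a′ b′) (i , j)
      term i j with (i , j) ≟² v | (i , j) ≟² v′
      ... | yes refl | yes eq′ = contradiction eq′ v≢v′
      ... | no _ | no _ with i Fin.<? j
      ...   | yes _ = trans (zeroˡ _) (sym (+-identityˡ 0#))
      ...   | no _  = sym (+-identityˡ 0#)
      term i j | yes refl | no _ with a Fin.<? b
      ...   | yes _  = trans (*-identityˡ _) (sym (+-identityʳ _))
      ...   | no a≮b = contradiction a<b a≮b
      term i j | no _ | yes refl with a′ Fin.<? b′
      ...   | yes _    = trans (-1*x≈-x _) (sym (+-identityˡ _))
      ...   | no a′≮b′ = contradiction a′<b′ a′≮b′

      vanishes : signedDistanceSum y ξ ≈ 0#
      vanishes = begin
        signedDistanceSum y ξ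
          ≈⟨ sum-cong-≋ (λ i → trans (sum-cong-≋ (term i))
               (∑-distrib-+ (λ j → at v (D a b) (i , j)) (λ j → at v′ (- D a′ b′) (i , j)))) ⟩
        sum (λ i → sum (λ j → at v (D a b) (i , j)) + sum (λ j → at v′ (- D a′ b′) (i , j)))
          ≈⟨ ∑-distrib-+ (λ i → sum λ j → at v (D a b) (i , j)) (λ i → sum λ j → at v′ (- D a′ b′) (i , j)) ⟩
        sum (λ i → sum (λ j → at v (D a b) (i , j))) + sum (λ i → sum (λ j → at v′ (- D a′ b′) (i , j)))
          ≈⟨ +-cong (sum-at v _) (sum-at v′ _) ⟩
        D a b - D a′ b′
          ≈⟨ +-congʳ eq ⟩
        D a′ b′ - D a′ b′
          ≈⟨ -‿inverseʳ _ ⟩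
        0# ∎
        where open ≈R

    -- Each of the two pairs is sorted, by symmetry of the distance, before the ordered version
    -- applies. The sorted pairs stay different because they share only `i`.
    distances-differ : ∀ {i j k} → i ≢ j → i ≢ k → j ≢ k → ¬ (D i j ≈ D i k)
    distances-differ {i} {j} {k} i≢j i≢k j≢k eq with Fin.<-cmp i j | Fin.<-cmp i k
    ... | tri≈ _ i≡j _ | _            = i≢j i≡j
    ... | _            | tri≈ _ i≡k _ = i≢k i≡k
    ... | tri< i<j _ _ | tri< i<k _ _ = ordered-distances-differ i<j i<k (λ { refl → j≢k refl }) eq
    ... | tri< i<j _ _ | tri> _ _ k<i = ordered-distances-differ i<j k<i (λ { refl → i≢j refl })
      (trans eq (dist-sym (y i) (y k)))
    ... | tri> _ _ j<i | tri< i<k _ _ = ordered-distances-differ j<i i<k (λ { refl → i≢j refl })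
      (trans (dist-sym (y j) (y i)) eq)
    ... | tri> _ _ j<i | tri> _ _ k<i = ordered-distances-differ j<i k<i (λ { refl → j≢k refl })
      (trans (dist-sym (y j) (y i)) (trans eq (dist-sym (y i) (y k))))

-- Traversing the unit ball

module _ (ℝ : RealNumbers) {d : ℕ} where
  open RealNumbers ℝ using (_≈_; _≤_; _+_; 0#; 1#; sym; trans; +-identityʳ; _≤?_; ≤-trans; ≤-reflexive; total; antisym)
  open Euclidean ℝ
  open Geometry ℝ

  Near : ∀ {m} → (Fin m → Point d) → Fin m → Fin m → Fin m → Set
  Near y c i j = dist (y c) (y i) ≤ dist (y c) (y j)

  module _ {m : ℕ} (y : Fin m → Point d) where

    private
      bb : Blackbox m
      bb = blackbox (distanceMatrix y)

    blackbox-true : ∀ {c i j} → bb ((c , i) ∷ []) ((c , j) ∷ []) ≡ true → Near y c i j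
    blackbox-true {c} {i} {j} eq with (dist (y c) (y i) + 0#) ≤? (dist (y c) (y j) + 0#)
    blackbox-true eq | yes le = ≤-trans (≤-reflexive (sym (+-identityʳ _))) (≤-trans le (≤-reflexive (+-identityʳ _)))
    blackbox-true () | no _

    blackbox-false : ∀ {c i j} → bb ((c , i) ∷ []) ((c , j) ∷ []) ≡ false → Near y c j i
    blackbox-false {c} {i} {j} eq
      with (dist (y c) (y i) + 0#) ≤? (dist (y c) (y j) + 0#) | total (dist (y c) (y i)) (dist (y c) (y j))
    blackbox-false () | yes _ | _
    blackbox-false eq | no _  | inj₂ ge = ge
    blackbox-false eq | no ≰  | inj₁ le = contradiction
      (≤-trans (≤-reflexive (+-identityʳ _)) (≤-trans le (≤-reflexive (sym (+-identityʳ _))))) ≰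

    open Correctness bb (Near y) blackbox-true blackbox-false ≤-trans public

  abstract
    program-solves : ∀ {m} (y : Fin m → Point d) → ∃ λ Ps → ∃ λ t →
      HaltsWith nearestNeighborProgram y Ps t × t ℕ.≤ 26 ℕ.* m ℕ.^ 3 ℕ.+ 26 × Solved y Ps
    program-solves {m} y = outcome (program-correct y)
      where
      -- Matching with a with-abstraction instead would normalise program-correct, which is infeasible.
      outcome : Triples.Reaches (blackbox (distanceMatrix y)) nearestNeighborProgram (initial m) (totalTime m)
                  (Solved y ∘ State.output) →
                ∃ λ Ps → ∃ λ t → HaltsWith nearestNeighborProgram y Ps t × t ℕ.≤ 26 ℕ.* m ℕ.^ 3 ℕ.+ 26 × Solved y Ps
      outcome (Triples.reaches {final} {time} run in-time holds) =
        State.output final , time , (final , run , refl) , ℕ.≤-trans in-time (totalTime-polynomial m) , holds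

  heuristic : PathFindingHeuristic d
  heuristic = record
    { program        = nearestNeighborProgram
    ; coeff          = 26
    ; degree         = 3
    ; polynomialTime = λ y _ →
        let Ps , t , halts , in-time , solved = program-solves y
        in Ps , t , halts , in-time , Solved.paths solved
    }

  grows⇒greedy : ∀ {X : PointSet d} {path} → Grows X path → ∃ λ x → Greedy (λ _ → ⊤) (Near (point X)) x path
  grows⇒greedy (start x)          = x , start tt
  grows⇒greedy (step g n∉ nearest) with x , greedy ← grows⇒greedy g =
    x , step greedy tt n∉ λ {z} _ → nearest z

  -- General position concerns positions in the list `S`, so points are replaced by their positions
  -- there. Different points have different positions, and two points each at least as near as the
  -- other would tie.
  nearest-unique : ∀ {n} (x : Fin n → Point d) (S : List (Fin n)) → GeneralPosition (x ∘ lookup S) →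
    ∀ {c i j} → c ∈ S → i ∈ S → j ∈ S → i ≢ c → j ≢ c → Near x c i j → Near x c j i → i ≡ j
  nearest-unique x S general {c} {i} {j} c∈ i∈ j∈ i≢c j≢c le ge with i Fin.≟ j
  ... | yes i≡j = i≡j
  ... | no  i≢j = contradiction tie
    (distances-differ (x ∘ lookup S) general (differ c∈ i∈ (i≢c ∘ ≡.sym)) (differ c∈ j∈ (j≢c ∘ ≡.sym)) (differ i∈ j∈ i≢j))
    where
    differ : ∀ {a b} (a∈ : a ∈ S) (b∈ : b ∈ S) → a ≢ b → Any.index a∈ ≢ Any.index b∈
    differ a∈ b∈ a≢b eq = a≢b (≡.trans (lookup-index a∈) (≡.trans (cong (lookup S) eq) (≡.sym (lookup-index b∈))))
    tie : dist (x (lookup S (Any.index c∈))) (x (lookup S (Any.index i∈)))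
          ≈ dist (x (lookup S (Any.index c∈))) (x (lookup S (Any.index j∈)))
    tie rewrite ≡.sym (lookup-index c∈) | ≡.sym (lookup-index i∈) | ≡.sym (lookup-index j∈) = antisym le ge

  module _ (X : PointSet d) (T : List (Fin (size X))) (grows : Grows X (reverse T)) (tour : IsTour T)
           (p : Point d) (annulus : EmptyAnnulus X p radius) where

    private
      S : List (Fin (size X))
      S = pointsInUnitBall X p

      InBall? : ∀ i → _
      InBall? i = dist p (point X i) ≤? 1#

      S-unique : Unique S
      S-unique = filter⁺ InBall? (allFin⁺ (size X))

    open DecMembership (Fin._≟_ {size X}) using (_∈?_)

    -- The empty annulus pushes a point outside the unit ball beyond distance `radius` from `p`,
    -- where it is farther from `s` than `s′` can be.
    unit-ball-isolated : ∀ {s s′ z} → s ∈ S → s′ ∈ S → z ∉ S → ¬ Near (point X) s z s′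
    unit-ball-isolated {s} {s′} {z} s∈ s′∈ z∉ = outside-unit-ball⇒farther p (point X s) (point X s′) (point X z)
      (proj₂ (∈-filter⁻ InBall? {xs = allFin _} s∈)) (proj₂ (∈-filter⁻ InBall? {xs = allFin _} s′∈))
      λ pz≤R → annulus z (pz≤R , λ pz≤1 → z∉ (∈-filter⁺ InBall? (∈-allFin z) pz≤1))

    -- Membership in the list produced by the heuristic

    Finds : List (Fin (size X)) → Set
    Finds P = ∀ {m} (y : Fin m → Point d) e → CongruentCopy X S y e →
      ∃ λ Ps → Produces heuristic y Ps × P ∈ map (map e) Ps

    finds-empty : (∀ z → z ∉ S) → Finds []
    finds-empty ∉S y e (perm , _) with Ps , t , halts , _ , solved ← program-solves y =
      Ps , (t , halts) , ∈-map⁺ (map e) (Solved.empty solved (m≡0 e perm))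
      where
      m≡0 : ∀ {m} (e : Fin m → Fin (size X)) → tabulate e ↭ S → m ≡ 0
      m≡0 {zero}  _ _    = refl
      m≡0 {suc m} e perm = contradiction (∈-resp-↭ perm (∈-tabulate⁺ {f = e} Fin.zero)) (∉S _)

    finds-greedy : GeneralPosition (point X ∘ lookup S) →
      ∀ {x Q} → Greedy (_∈ S) (Near (point X)) x Q → Q ↭ S → Finds (reverse Q)
    finds-greedy general {x} {Q} greedy Q↭S {m} y e (perm , φ , isometry , y≋)
      with ∈-tabulate⁻ (∈-resp-↭ (↭-sym perm) (greedy⇒start greedy)) | program-solves y
    -- The first point of `Q` is `e k`, so the run from `k` is the one that reproduces `Q`. The
    -- isometry preserves all comparisons of distances, hence its image under `e` is greedy within
    -- `S`.
    ... | k , refl | Ps , t , halts , _ , solved with Solved.greedy solved k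
    ...   | vis , visGreedy , length≡m , vis∈ = Ps , (t , halts) ,
      subst (_∈ map (map e) Ps) (≡.trans (reverse-map e vis) (cong reverse same)) (∈-map⁺ (map e) vis∈)
      where
      e-injective : ∀ {i j} → e i ≡ e j → i ≡ j
      e-injective = unique-tabulate⇒injective (Unique-resp-↭ (≡.setoid _) (↭⇒↭ₛ (↭-sym perm)) S-unique)

      copy-dist : ∀ i j → dist (y i) (y j) ≈ dist (point X (e i)) (point X (e j))
      copy-dist i j = trans (dist-resp-≋ (y i) (y j) (φ (point X (e i))) (φ (point X (e j))) (y≋ i) (y≋ j))
                            (isometry (point X (e i)) (point X (e j)))

      copied : Greedy (_∈ S) (Near (point X)) (e k) (map e vis)
      copied = greedy-map e-injective (λ {i} _ → ∈-resp-↭ perm (∈-tabulate⁺ i))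
        (λ b∈ → let i , b≡ = ∈-tabulate⁻ (∈-resp-↭ (↭-sym perm) b∈) in i , tt , ≡.sym b≡)
        (λ {c} {i} {j} le → ≤-trans (≤-reflexive (sym (copy-dist c i))) (≤-trans le (≤-reflexive (copy-dist c j))))
        visGreedy

      length≡ : length (map e vis) ≡ length Q
      length≡ = begin
        length (map e vis)   ≡⟨ length-map e vis ⟩
        length vis           ≡⟨ length≡m ⟩
        m                    ≡⟨ length-tabulate e ⟨
        length (tabulate e)  ≡⟨ ↭-length perm ⟩
        length S             ≡⟨ ↭-length Q↭S ⟨
        length Q             ∎
        where open ≡.≡-Reasoning

      same : map e vis ≡ Q
      same = greedy-deterministic (nearest-unique (point X) S general) copied greedy length≡

    Traversal : Set
    Traversal = ∃ λ P → TraversesIn T S P × Finds P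

    nothing-to-traverse : (∀ z → z ∉ S) → Traversal
    nothing-to-traverse ∉S =
      [] , (unique∧set⇒↭ [] S-unique (λ ()) (λ {z} z∈ → contradiction z∈ (∉S z)) , []) , finds-empty ∉S

    -- Greedy paths list the newest point first and the tour lists the oldest first. The reversal of
    -- the segment `Q` is a segment of `T`, so its consecutive points are joined by tour edges.
    segment-traverses : GeneralPosition (point X ∘ lookup S) → ∀ {x} A Q B → reverse T ≡ A ++ Q ++ B →
      Greedy (_∈ S) (Near (point X)) x Q → (∀ {z} → z ∈ S → z ∈ Q) → Traversal
    segment-traverses general A Q B eq greedy full =
      reverse Q , (↭-trans (↭-reverse Q) Q↭S , Linked.map inj₁ linked) , finds-greedy general greedy Q↭S
      where
      Q↭S : Q ↭ S
      Q↭S = unique∧set⇒↭ (greedy⇒unique greedy) S-unique (All.lookup (greedy⇒all greedy)) full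

      T≡ : T ≡ (reverse B ++ reverse Q) ++ reverse A
      T≡ = begin
        T                                      ≡⟨ reverse-involutive T ⟨
        reverse (reverse T)                    ≡⟨ cong reverse eq ⟩
        reverse (A ++ Q ++ B)                  ≡⟨ reverse-++ A (Q ++ B) ⟩
        reverse (Q ++ B) ++ reverse A          ≡⟨ cong (_++ reverse A) (reverse-++ Q B) ⟩
        (reverse B ++ reverse Q) ++ reverse A  ∎
        where open ≡.≡-Reasoning

      linked : Linked (λ i j → (i , j) ∈ cyclicPairs T) (reverse Q)
      linked = ++⁻ʳ-linked (reverse B) (++⁻ˡ-linked (reverse B ++ reverse Q)
        (subst (Linked _) T≡ (linked-cyclicPairs T)))

    ball-traversal : GeneralPosition (point X ∘ lookup S) → Traversal
    ball-traversal general =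
      [ nothing-to-traverse
      , (λ (A , Q , B , _ , eq , greedy , full) → segment-traverses general A Q B eq greedy full)
      ]′ (greedy-traverses Fin._≟_ (_∈? S) unit-ball-isolated (proj₂ (grows⇒greedy grows))
            λ z → ∈-resp-↭ (↭-sym (↭-trans (↭-reverse T) tour)) (∈-allFin z))

fact2p4 : (ℝ : RealNumbers) (d : ℕ) → let open Euclidean ℝ in Scalefree (NearestNeighbor {d})
fact2p4 ℝ d = Geometry.radius ℝ , heuristic ℝ , λ X T (grows , tour) p annulus →
  ball-traversal ℝ X T grows tour p annulus
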